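{- Fix $m\geq1$. Let $M$ be a rank-$k$ loopless matroid and let $Q=Q_m(M)$. Then each of the $\mathcal{G}$-invariants $\mathcal{G}(Q\setminus a)$, $\mathcal{G}(Q\setminus E)$ and $\mathcal{G}(Q\setminus(E\cup\{a\}))$ can be computed from $\mathcal{G}(M)$; that is, for loopless matroids $M,N$ with $\mathcal{G}(M)=\mathcal{G}(N)$, we have $\mathcal{G}(Q_m(M)\setminus a)=\mathcal{G}(Q_m(N)\setminus a)$, $\mathcal{G}(Q_m(M)\setminus E(M))=\mathcal{G}(Q_m(N)\setminus E(N))$, and $\mathcal{G}(Q_m(M)\setminus(E(M)\cup\{a\}))=\mathcal{G}(Q_m(N)\setminus(E(N)\cup\{a\}))$.
   Context: For a rank-$k$ matroid $M$ on an $n$-set $E$ and a bijection $\pi:[n]\to E$, the rank sequence $\underline{r}(\pi)=r_1\cdots r_n$ has $r_i=r(\{\pi(1),\dots,\pi(i)\})-r(\{\pi(1),\dots,\pi(i-1)\})$, and $\mathcal{G}(M)=\sum_\pi[\underline{r}(\pi)]$, a formal linear combination (over a field of characteristic zero) of symbols indexed by 0/1 sequences. Cyclic set: $X$ with $M|X$ having no coloops; cyclic flat: a flat that is cyclic; $\mathcal{Z}(M)$: the set of cyclic flats. Free $m$-cone: let $M=(E,r)$ be loopless and $m\geq1$. For each $e\in E$ let $T_e$ be a set of $m$ new elements (pairwise disjoint, disjoint from $E$), $T=\bigcup_e T_e$, and $a$ a further new element (the tip); $E(Q)=E\cup T\cup\{a\}$. For $S\subseteq E$ let $q(S)=S\cup\{a\}\cup\bigcup_{e\in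 S}T_e$. The free $m$-cone $Q_m(M)$ is the unique matroid on $E(Q)$ whose cyclic flats are exactly the sets in $\mathcal{Z}(M)\cup\{q(F):F\text{ a nonempty flat of }M\}$, with rank $r(Z)$ on $Z\in\mathcal{Z}(M)$ and rank $r(F)+1$ on $q(F)$. -}

module Defs where

open import Data.Nat using (ℕ; zero; suc; _+_; _*_; _∸_; _≤_; _<_)
open import Data.Bool using (Bool; true; false)
open import Data.Fin using (Fin)
import Data.Fin.Properties as FinP
open import Data.Fin.Subset using (Subset; _∈_; _∉_; _⊆_; _∪_; _∩_; ⁅_⁆; ⊥; ⊤; ∣_∣; Nonempty; _-_)
open import Data.Fin.Subset.Properties using (_∈?_)
open import Data.Vec using (Vec; _++_; replicate; concat; map; [_])
open import Data.List using (List; []; _∷_; length; filter; allFin; cartesianProductWith)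
open import Data.List.Relation.Unary.All using (All; all?)
import Data.List.Relation.Unary.Unique.DecPropositional as UniqueDec
import Data.List.Properties as ListP
open import Data.Nat.Properties using (_≟_)
open import Data.Product using (_×_; Σ; ∃; _,_)
open import Data.Sum using (_⊎_)
open import Relation.Binary.PropositionalEquality using (_≡_)
open import Relation.Nullary using (Dec; _×-dec_)
open import Function.Bundles using (_⇔_)

record Matroid (n : ℕ) : Set where
  field
    r    : Subset n → ℕ
    R1   : ∀ X → r X ≤ ∣ X ∣
    R2   : ∀ X Y → X ⊆ Y → r X ≤ r Y
    R3   : ∀ X Y → r (X ∪ Y) + r (X ∩ Y) ≤ r X + r Y
open Matroid public

Loopless : ∀ {n} → Matroid n → Set
Loopless M = ∀ e → r M ⁅ e ⁆ ≡ 1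

IsFlat : ∀ {n} → Matroid n → Subset n → Set
IsFlat M F = ∀ e → e ∉ F → r M F < r M (F ∪ ⁅ e ⁆)

IsCyclic : ∀ {n} → Matroid n → Subset n → Set
IsCyclic M X = ∀ e → e ∈ X → r M (X - e) ≡ r M X

IsCyclicFlat : ∀ {n} → Matroid n → Subset n → Set
IsCyclicFlat M Z = IsFlat M Z × IsCyclic M Z

-- G-invariant.
-- G(M|X) as the coefficient function: for a symbol s (a sequence),
-- the number of bijections π : [|X|] → X (listed as duplicate-free lists of
-- elements of X of length |X|) whose rank sequence equals s.
-- G(M \ D) = G(M | (E - D)) (deletion = restriction to the complement).

rankSeqFrom : ∀ {n} → (Subset n → ℕ) → Subset n → List (Fin n) → List ℕ
rankSeqFrom rk acc []       = []
rankSeqFrom rk acc (e ∷ π)  =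
  (rk (acc ∪ ⁅ e ⁆) ∸ rk acc) ∷ rankSeqFrom rk (acc ∪ ⁅ e ⁆) π

rankSeq : ∀ {n} → (Subset n → ℕ) → List (Fin n) → List ℕ
rankSeq rk π = rankSeqFrom rk ⊥ π

listsOfLength : ∀ {n} → ℕ → List (List (Fin n))
listsOfLength {n} zero    = [] ∷ []
listsOfLength {n} (suc k) = cartesianProductWith _∷_ (allFin n) (listsOfLength k)

IsArrangement : ∀ {n} → Matroid n → Subset n → List ℕ → List (Fin n) → Set
IsArrangement M X s π =
  All (_∈ X) π × UniqueDec.Unique FinP._≟_ π × rankSeq (r M) π ≡ s

isArrangement? : ∀ {n} (M : Matroid n) X s π → Dec (IsArrangement M X s π)
isArrangement? M X s π =
  all? (_∈? X) π ×-dec (UniqueDec.unique? FinP._≟_ π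
    ×-dec ListP.≡-dec _≟_ (rankSeq (r M) π) s)

GRestr : ∀ {n} → Matroid n → Subset n → List ℕ → ℕ
GRestr M X s = length (filter (isArrangement? M X s) (listsOfLength ∣ X ∣))

G : ∀ {n} → Matroid n → List ℕ → ℕ
G M s = GRestr M ⊤ s

-- Free m-cone.
-- Ground set of Q_m(M) for E = Fin n: Fin ((n + n * m) + 1), laid out as
--   E (first n), then T = ⋃ T_e with T_e = {e} × Fin m in block order
--   (element (e , j) at position n + e*m + j), then the tip a (last).

coneSize : ℕ → ℕ → ℕ
coneSize n m = (n + n * m) + 1

embed : ∀ {n} m → Subset n → Subset (coneSize n m)
embed m S = (S ++ replicate _ false) ++ [ false ]

-- q(S) = S ∪ {a} ∪ ⋃_{e ∈ S} T_e
qSet : ∀ {n} m → Subset n → Subset (coneSize n m)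
qSet m S = (S ++ concat (map (λ b → replicate m b) S)) ++ [ true ]

withoutTip : ∀ n m → Subset (coneSize n m)
withoutTip n m = (⊤ {n} ++ ⊤ {n * m}) ++ [ false ]

withoutE : ∀ n m → Subset (coneSize n m)
withoutE n m = (⊥ {n} ++ ⊤ {n * m}) ++ [ true ]

withoutEa : ∀ n m → Subset (coneSize n m)
withoutEa n m = (⊥ {n} ++ ⊤ {n * m}) ++ [ false ]

record IsFreeCone {n} (m : ℕ) (M : Matroid n) (Q : Matroid (coneSize n m)) : Set where
  field
    cyclicFlats : ∀ Z → IsCyclicFlat Q Z ⇔
      ((Σ (Subset n) λ Z' → IsCyclicFlat M Z' × Z ≡ embed m Z')
       ⊎ (Σ (Subset n) λ F → IsFlat M F × Nonempty F × Z ≡ qSet m F))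
    rankZ : ∀ Z → IsCyclicFlat M Z → r Q (embed m Z) ≡ r M Z
    rankQ : ∀ F → IsFlat M F → Nonempty F → r Q (qSet m F) ≡ r M F + 1

{-# OPTIONS --safe #-}
module Submission where

-- A prefix X of an arrangement of the cone has rank min (r (X ∩ E) + |X - E|) (r (supp X) + 1),
-- where supp X ⊆ E is the set of elements below members of X; this follows from
-- r X = min { r Z + |X - Z| : Z a cyclic flat }. The first term minus r (supp X) never decreases
-- along an arrangement, so the rank sequence is governed by the last prefix X at which
-- r (X ∩ E) + |X - E| ≤ r (supp X). This condition says that the elements below X - E are
-- coloops of M | supp X, so it and all relevant ranks can be read off the single permutation of E that lists
-- X ∩ E first, then the elements below X - E, then the rest by first occurrence.
-- Averaging over relabellings of E turns the count into a sum over all permutations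
-- of E of a function of the rank sequence, hence into a function of G(M).

-- `G` records ranks along one maximal chain of subsets of E at a time and never relates two
-- incomparable sets. A cone arrangement involves two chains, the sets `bases` and the sets
-- `support`; they join into one chain only if `bases` is followed up to a fixed prefix and
-- `support` from there on. The event that a given prefix `xs` is the last tight one breaks this: if
-- the next element is `base e`, deciding it involves both `support xs` and `bases xs` with e added,
-- which need not be comparable. Since tightness passes to prefixes, the indicator of the event is
-- the indicator for `xs` minus the one for `xs ∷ʳ x`, and each of these needs a single chain. Over
-- the natural numbers the subtraction becomes adding a term to both sides and cancelling it.
-- Holding the cone arrangement fixed while the labels of E vary keeps the chain fixed too, so one
-- reordering of E, the same for all relabellings and for both matroids, reads off all the ranks.

open import Defs
open import Algebra.Properties.CommutativeSemigroup using (interchange; x∙yz≈xz∙y)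
open import Data.Bool using (Bool; true; false)
open import Data.Fin using (Fin; toℕ; zero; suc; _↑ˡ_; _↑ʳ_; combine; splitAt; remQuot; fromℕ<)
import Data.Fin.Properties as Fin
open import Data.Fin.Subset using (Subset; ⊥; ⊤; ⁅_⁆; ∣_∣; _∪_; _∩_; _-_; Nonempty) renaming (_∈_ to _∈ˢ_; _∉_ to _∉ˢ_; _⊆_ to _⊆ˢ_)
open import Data.Fin.Subset.Properties using (_∈?_; nonempty?; ∣p∣≤n; ∣⊤∣≡n; ∣⊥∣≡0; ∈⊤; ∉⊥; x∈⁅x⁆; x∈⁅y⁆⇒x≡y; ∣⁅x⁆∣≡1; ⊆-antisym; x∈p∩q⁺; p⊆p∪q; x∈p∪q⁻; x∈p∪q⁺; p⊂q⇒∣p∣<∣q∣; p─q⊆p; x∈p∧x≢y⇒x∈p-y)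
open import Data.List using (List; []; _∷_; _++_; _∷ʳ_; length; map; filter; foldl; take; allFin)
open import Data.List.Membership.Propositional using (_∈_)
open import Data.List.Membership.Propositional.Properties using (∈-++⁺ˡ; ∈-++⁺ʳ; ∈-++⁻; ∈-∃++; ∈-map⁺; ∈-map⁻; ∈-filter⁺; ∈-filter⁻; ∈-allFin; ∈-length; ∈-cartesianProductWith⁺; ∈-cartesianProductWith⁻)
import Data.List.Membership.DecPropositional as DecMembership
import Data.List.Properties as List
open import Data.List.Relation.Binary.Permutation.Propositional using (_↭_; ↭-refl; ↭-trans; ↭-sym; prep)
import Data.List.Relation.Binary.Permutation.Propositional.Properties as Perm
open import Data.List.Relation.Binary.Subset.Propositional using (_⊆_)
open import Data.List.Relation.Unary.All as All using (All; []; _∷_; all?)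
import Data.List.Relation.Unary.All.Properties as All
open import Data.List.Relation.Unary.AllPairs using ([]; _∷_)
open import Data.List.Relation.Unary.Any using (here; there)
open import Data.List.Relation.Unary.Unique.Propositional using (Unique)
import Data.List.Relation.Unary.Unique.DecPropositional as UniqueDec
import Data.List.Relation.Unary.Unique.Propositional.Properties as Unique
open import Data.Nat using (ℕ; zero; suc; _+_; _*_; _∸_; _⊓_; _≤_; _<_; z≤n; s≤s; s≤s⁻¹; _≤?_; _<?_; NonZero; >-nonZero)
open import Data.Nat.ListAction using (sum)
open import Data.Nat.ListAction.Properties using (sum-↭)
open import Data.Nat.Properties
open import Data.Product using (Σ; ∃; ∃₂; _×_; _,_; proj₁; proj₂)
open import Data.Sum using (_⊎_; inj₁; inj₂; [_,_]′)
open import Data.Vec as Vec using (lookup; here; there; _∷_)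
import Data.Vec.Properties as Vec
open import Function using (_∘_; id)
open import Function.Bundles using (Equivalence)
open import Relation.Binary.Definitions using (DecidableEquality)
open import Relation.Binary.PropositionalEquality using (_≡_; refl; sym; trans; cong; cong₂; subst; subst₂; module ≡-Reasoning)
open import Relation.Nullary using (Dec; yes; no; ¬_; _×-dec_; ¬?; contradiction)
open import Relation.Unary using (Decidable)

-- Finite sums and multisets

∑ : {A : Set} → List A → (A → ℕ) → ℕ
∑ xs f = sum (map f xs)

module _ {A : Set} where

  ∑-cong : ∀ {f g : A → ℕ} xs → (∀ {x} → x ∈ xs → f x ≡ g x) → ∑ xs f ≡ ∑ xs g
  ∑-cong []       _ = refl
  ∑-cong (x ∷ xs) h = cong₂ _+_ (h (here refl)) (∑-cong xs (h ∘ there))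

  ∑-distrib-+ : ∀ (f g : A → ℕ) xs → ∑ xs (λ x → f x + g x) ≡ ∑ xs f + ∑ xs g
  ∑-distrib-+ f g []       = refl
  ∑-distrib-+ f g (x ∷ xs) = begin
    f x + g x + ∑ xs (λ y → f y + g y) ≡⟨ cong (f x + g x +_) (∑-distrib-+ f g xs) ⟩
    f x + g x + (∑ xs f + ∑ xs g)      ≡⟨ interchange +-commutativeSemigroup (f x) (g x) (∑ xs f) (∑ xs g) ⟩
    f x + ∑ xs f + (g x + ∑ xs g)      ∎
    where open ≡-Reasoning

  ∑-const : ∀ c (xs : List A) → ∑ xs (λ _ → c) ≡ length xs * c
  ∑-const c []       = refl
  ∑-const c (_ ∷ xs) = cong (c +_) (∑-const c xs)

  ∑-↭ : ∀ (f : A → ℕ) {xs ys} → xs ↭ ys → ∑ xs f ≡ ∑ ys f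
  ∑-↭ f p = sum-↭ (Perm.map⁺ f p)

∑-map : ∀ {A B : Set} (f : B → ℕ) (g : A → B) xs → ∑ (map g xs) f ≡ ∑ xs (f ∘ g)
∑-map f g xs = cong sum (sym (List.map-∘ xs))

∑-swap : ∀ {A B : Set} (f : A → B → ℕ) xs ys →
         ∑ xs (λ x → ∑ ys (f x)) ≡ ∑ ys (λ y → ∑ xs (λ x → f x y))
∑-swap f []       ys = sym (trans (∑-const 0 ys) (*-zeroʳ (length ys)))
∑-swap f (x ∷ xs) ys = begin
  ∑ ys (f x) + ∑ xs (λ x → ∑ ys (f x))         ≡⟨ cong (∑ ys (f x) +_) (∑-swap f xs ys) ⟩
  ∑ ys (f x) + ∑ ys (λ y → ∑ xs (λ x → f x y)) ≡⟨ ∑-distrib-+ (f x) _ ys ⟨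
  ∑ ys (λ y → f x y + ∑ xs (λ x → f x y))      ∎
  where open ≡-Reasoning

𝟙 : ∀ {P : Set} → Dec P → ℕ
𝟙 (yes _) = 1
𝟙 (no _)  = 0

module _ {A : Set} where

  -- Each entry of `xs` is cut out of `ys` in turn; as `xs` has no repetition, the later entries
  -- survive in what remains. The pigeonhole arguments below are statements about the leftover `zs`.
  unique-complement : ∀ {xs ys : List A} → Unique xs → xs ⊆ ys → ∃ λ zs → ys ↭ xs ++ zs
  unique-complement {[]} {ys} _ _ = ys , ↭-refl
  unique-complement {x ∷ xs} (x∉xs ∷ xs!) xs⊆ys with ∈-∃++ (xs⊆ys (here refl))
  ... | as , bs , refl with unique-complement {xs} {as ++ bs} xs! (λ {y} y∈xs →
          [ ∈-++⁺ˡ , (λ { (here refl) → contradiction refl (All.lookup x∉xs y∈xs)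
                        ; (there y∈bs) → ∈-++⁺ʳ as y∈bs }) ]′ (∈-++⁻ as (xs⊆ys (there y∈xs))))
  ...   | zs , p = zs , ↭-trans (Perm.shift x as bs) (prep x p)

  unique⇒length≤ : ∀ {xs ys : List A} → Unique xs → xs ⊆ ys → length xs ≤ length ys
  unique⇒length≤ {xs} xs! xs⊆ys with unique-complement xs! xs⊆ys
  ... | zs , p = ≤-trans (m≤m+n (length xs) (length zs))
                   (≤-reflexive (sym (trans (Perm.↭-length p) (List.length-++ xs))))

  map-unique : ∀ {B : Set} (φ : A → B) {xs} → Unique xs →
               (∀ {x y} → x ∈ xs → y ∈ xs → φ x ≡ φ y → x ≡ y) → Unique (map φ xs)
  map-unique φ [] _ = []
  map-unique φ (x∉xs ∷ xs!) inj =
    All.map⁺ (All.tabulate (λ y∈xs eq → All.lookup x∉xs y∈xs (inj (here refl) (there y∈xs) eq)))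
    ∷ map-unique φ xs! (λ x∈ y∈ → inj (there x∈) (there y∈))

  -- No inverse of `φ` has to be built: `map φ xs` lies inside `xs` and has the same length, so the
  -- leftover of `unique-complement` is empty.
  ∑-reindex : ∀ (f : A → ℕ) {xs} (φ : A → A) → Unique xs → (∀ {x} → x ∈ xs → φ x ∈ xs) →
              (∀ {x y} → x ∈ xs → y ∈ xs → φ x ≡ φ y → x ≡ y) → ∑ xs (f ∘ φ) ≡ ∑ xs f
  ∑-reindex f {xs} φ xs! closed inj
    with unique-complement (map-unique φ xs! inj)
           (λ y∈ → let (x , x∈ , eq) = ∈-map⁻ φ y∈ in subst (_∈ xs) (sym eq) (closed x∈))
  ... | [] , p = sym (trans (∑-↭ f p) (cong sum (trans (cong (map f) (List.++-identityʳ (map φ xs)))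
                   (sym (List.map-∘ xs)))))
  ... | z ∷ zs , p = contradiction (trans (Perm.↭-length p) (List.length-++ (map φ xs)))
                       (λ eq → m≢1+m+n (length xs) (trans eq (trans
                         (cong (_+ suc (length zs)) (List.length-map φ xs)) (+-suc (length xs) (length zs)))))

  module _ (_≟ᴬ_ : DecidableEquality A) where

    count : A → List A → ℕ
    count s xs = ∑ xs (λ x → 𝟙 (x ≟ᴬ s))

    count-self : ∀ x xs → count x (x ∷ xs) ≡ suc (count x xs)
    count-self x xs with x ≟ᴬ x
    ... | yes _ = refl
    ... | no x≢ = contradiction refl x≢

    count>0⇒∈ : ∀ s xs → 0 < count s xs → s ∈ xs
    count>0⇒∈ s (x ∷ xs) pos with x ≟ᴬ s
    ... | yes eq = here (sym eq)
    ... | no _   = there (count>0⇒∈ s xs pos)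

    ∈⇒count>0 : ∀ {s xs} → s ∈ xs → 0 < count s xs
    ∈⇒count>0 {s} {x ∷ xs} (here refl) = subst (0 <_) (sym (count-self x xs)) (s≤s z≤n)
    ∈⇒count>0 {s} {x ∷ xs} (there s∈)  = ≤-trans (∈⇒count>0 s∈) (m≤n+m _ (𝟙 (x ≟ᴬ s)))

    counts≡⇒↭ : ∀ xs ys → (∀ s → count s xs ≡ count s ys) → xs ↭ ys
    counts≡⇒↭ [] [] _ = ↭-refl
    counts≡⇒↭ [] (y ∷ ys) eq = contradiction (trans (eq y) (count-self y ys)) λ ()
    counts≡⇒↭ (x ∷ xs) ys eq
      with ∈-∃++ (count>0⇒∈ x ys (subst (0 <_) (trans (sym (count-self x xs)) (eq x)) (s≤s z≤n)))
    ... | as , bs , refl = ↭-trans (prep x (counts≡⇒↭ xs (as ++ bs) λ s →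
            +-cancelˡ-≡ (𝟙 (x ≟ᴬ s)) _ _ (trans (eq s) (∑-↭ (λ y → 𝟙 (y ≟ᴬ s)) (Perm.shift x as bs)))))
            (↭-sym (Perm.shift x as bs))

    -- Appending on the right makes a left fold keep first occurrences in order and only ever extend
    -- its accumulator; `completion` relies on this.
    insert : List A → A → List A
    insert acc x with DecMembership._∈?_ _≟ᴬ_ x acc
    ... | yes _ = acc
    ... | no _  = acc ∷ʳ x

    insertAll : List A → List A → List A
    insertAll = foldl insert

    insert-extends : ∀ acc x → ∃ λ ext → insert acc x ≡ acc ++ ext
    insert-extends acc x with DecMembership._∈?_ _≟ᴬ_ x acc
    ... | yes _ = [] , sym (List.++-identityʳ acc)
    ... | no _  = x ∷ [] , refl

    insert-unique : ∀ {acc} x → Unique acc → Unique (insert acc x)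
    insert-unique {acc} x acc! with DecMembership._∈?_ _≟ᴬ_ x acc
    ... | yes _ = acc!
    ... | no x∉ = Unique.++⁺ acc! ([] ∷ []) λ { (v∈ , here refl) → x∉ v∈ }

    insert-∋ : ∀ acc x → x ∈ insert acc x
    insert-∋ acc x with DecMembership._∈?_ _≟ᴬ_ x acc
    ... | yes x∈ = x∈
    ... | no _   = ∈-++⁺ʳ acc (here refl)

    insert-⊆ : ∀ acc x → insert acc x ⊆ acc ∷ʳ x
    insert-⊆ acc x with DecMembership._∈?_ _≟ᴬ_ x acc
    ... | yes _ = ∈-++⁺ˡ
    ... | no _  = id

    insertAll-extends : ∀ acc xs → ∃ λ ext → insertAll acc xs ≡ acc ++ ext
    insertAll-extends acc []       = [] , sym (List.++-identityʳ acc)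
    insertAll-extends acc (x ∷ xs) with insert-extends acc x | insertAll-extends (insert acc x) xs
    ... | e₁ , eq₁ | e₂ , eq₂ =
      e₁ ++ e₂ , trans eq₂ (trans (cong (_++ e₂) eq₁) (List.++-assoc acc e₁ e₂))

    insertAll-unique : ∀ {acc} xs → Unique acc → Unique (insertAll acc xs)
    insertAll-unique []       acc! = acc!
    insertAll-unique (x ∷ xs) acc! = insertAll-unique xs (insert-unique x acc!)

    insertAll-⊇acc : ∀ acc xs → acc ⊆ insertAll acc xs
    insertAll-⊇acc acc xs {y} y∈ with insertAll-extends acc xs
    ... | _ , eq = subst (y ∈_) (sym eq) (∈-++⁺ˡ y∈)

    insertAll-⊇ : ∀ acc xs → xs ⊆ insertAll acc xs
    insertAll-⊇ acc (x ∷ xs) (here refl) = insertAll-⊇acc (insert acc x) xs (insert-∋ acc x)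
    insertAll-⊇ acc (x ∷ xs) (there y∈)  = insertAll-⊇ (insert acc x) xs y∈

    insertAll-⊆ : ∀ acc xs → insertAll acc xs ⊆ acc ++ xs
    insertAll-⊆ acc [] y∈ = ∈-++⁺ˡ y∈
    insertAll-⊆ acc (x ∷ xs) {y} y∈ = subst (y ∈_) (List.++-assoc acc (x ∷ []) xs)
      ([ ∈-++⁺ˡ ∘ insert-⊆ acc x , ∈-++⁺ʳ (acc ∷ʳ x) ]′
         (∈-++⁻ (insert acc x) (insertAll-⊆ (insert acc x) xs y∈)))

-- Arrangements and permutations

∈-listsOfLength⁺ : ∀ {n} (π : List (Fin n)) → π ∈ listsOfLength (length π)
∈-listsOfLength⁺ []      = here refl
∈-listsOfLength⁺ (x ∷ π) = ∈-cartesianProductWith⁺ _∷_ (∈-allFin x) (∈-listsOfLength⁺ π)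

∈-listsOfLength⁻ : ∀ {n} k {π : List (Fin n)} → π ∈ listsOfLength k → length π ≡ k
∈-listsOfLength⁻ zero    (here refl) = refl
∈-listsOfLength⁻ {n} (suc k) π∈ with ∈-cartesianProductWith⁻ _∷_ (allFin n) (listsOfLength k) π∈
... | _ , _ , _ , π′∈ , refl = cong suc (∈-listsOfLength⁻ k π′∈)

listsOfLength-unique : ∀ {n} k → Unique (listsOfLength {n} k)
listsOfLength-unique zero        = [] ∷ []
listsOfLength-unique {n} (suc k) =
  Unique.cartesianProductWith⁺ _∷_ List.∷-injective (Unique.allFin⁺ n) (listsOfLength-unique k)

isArrangementOf? : ∀ {n} (X : Subset n) → Decidable (λ π → All (_∈ˢ X) π × Unique π)
isArrangementOf? X π = all? (_∈? X) π ×-dec UniqueDec.unique? Fin._≟_ π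

arrangements : ∀ {n} → Subset n → List (List (Fin n))
arrangements X = filter (isArrangementOf? X) (listsOfLength ∣ X ∣)

arrangements-unique : ∀ {n} (X : Subset n) → Unique (arrangements X)
arrangements-unique X = Unique.filter⁺ (isArrangementOf? X) (listsOfLength-unique ∣ X ∣)

module _ {n : ℕ} {X : Subset n} {π : List (Fin n)} where

  ∈-arrangements⁺ : All (_∈ˢ X) π → Unique π → length π ≡ ∣ X ∣ → π ∈ arrangements X
  ∈-arrangements⁺ π⊆X π! len = ∈-filter⁺ (isArrangementOf? X)
    (subst (λ k → π ∈ listsOfLength k) len (∈-listsOfLength⁺ π)) (π⊆X , π!)

  ∈-arrangements⁻ : π ∈ arrangements X → All (_∈ˢ X) π × Unique π × length π ≡ ∣ X ∣
  ∈-arrangements⁻ π∈ with ∈-filter⁻ (isArrangementOf? X) {xs = listsOfLength ∣ X ∣} π∈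
  ... | π∈L , π⊆X , π! = π⊆X , π! , ∈-listsOfLength⁻ ∣ X ∣ π∈L

∑-map-arrangements : ∀ {n} (X : Subset n) (g : Fin n → Fin n) → (∀ {x y} → g x ≡ g y → x ≡ y) →
                     (∀ {x} → x ∈ˢ X → g x ∈ˢ X) → ∀ f →
                     ∑ (arrangements X) (f ∘ map g) ≡ ∑ (arrangements X) f
∑-map-arrangements X g inj closed f = ∑-reindex f (map g) (arrangements-unique X)
  (λ {π} π∈ → let (π⊆X , π! , len) = ∈-arrangements⁻ π∈ in
     ∈-arrangements⁺ (All.map⁺ (All.map closed π⊆X)) (Unique.map⁺ inj π!)
       (trans (List.length-map g π) len))
  (λ _ _ → List.map-injective inj)

_≟ᴸ_ : DecidableEquality (List ℕ)
_≟ᴸ_ = List.≡-dec _≟_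

-- Separates the condition on the rank sequence from those on the list itself, so that the index set
-- of the resulting sum no longer mentions the matroid.
length-filter-× : ∀ {A : Set} {P U Q : A → Set} (p? : Decidable P) (u? : Decidable U) (q? : Decidable Q) xs →
  length (filter (λ x → p? x ×-dec (u? x ×-dec q? x)) xs) ≡ ∑ (filter (λ x → p? x ×-dec u? x) xs) (𝟙 ∘ q?)
length-filter-× p? u? q? [] = refl
length-filter-× p? u? q? (x ∷ xs) with p? x | u? x
... | no _  | _    = length-filter-× p? u? q? xs
... | yes _ | no _ = length-filter-× p? u? q? xs
... | yes _ | yes _ with q? x
...   | yes _ = cong suc (length-filter-× p? u? q? xs)
...   | no _  = length-filter-× p? u? q? xs

GRestr-∑ : ∀ {n} (M : Matroid n) X s →
           GRestr M X s ≡ ∑ (arrangements X) (λ π → 𝟙 (rankSeq (r M) π ≟ᴸ s))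
GRestr-∑ M X s = length-filter-× (all? (_∈? X)) (UniqueDec.unique? Fin._≟_)
  (λ π → rankSeq (r M) π ≟ᴸ s) (listsOfLength ∣ X ∣)

permutations : ∀ n → List (List (Fin n))
permutations n = arrangements (⊤ {n})

∈-permutations⁺ : ∀ {n} {π : List (Fin n)} → Unique π → length π ≡ n → π ∈ permutations n
∈-permutations⁺ {n} π! len =
  ∈-arrangements⁺ (All.tabulate (λ _ → ∈⊤)) π! (trans len (sym (∣⊤∣≡n n)))

∈-permutations⁻ : ∀ {n} {π : List (Fin n)} → π ∈ permutations n → Unique π × length π ≡ n
∈-permutations⁻ {n} π∈ with ∈-arrangements⁻ {X = ⊤ {n}} π∈
... | _ , π! , len = π! , trans len (∣⊤∣≡n n)

allFin∈permutations : ∀ n → allFin n ∈ permutations n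
allFin∈permutations n = ∈-permutations⁺ (Unique.allFin⁺ n) (List.length-tabulate id)

-- Lists as permutations of E

-- The last argument is returned when the index is out of range.
nth : ∀ {A : Set} → List A → ℕ → A → A
nth []       _       d = d
nth (x ∷ xs) zero    _ = x
nth (x ∷ xs) (suc i) d = nth xs i d

module _ {A : Set} where

  nth-∈ : ∀ (xs : List A) {i d} → i < length xs → nth xs i d ∈ xs
  nth-∈ (x ∷ xs) {zero}  _         = here refl
  nth-∈ (x ∷ xs) {suc i} (s≤s i<n) = there (nth-∈ xs i<n)

  nth-injective : ∀ {xs : List A} {i j d e} → Unique xs → i < length xs → j < length xs →
                  nth xs i d ≡ nth xs j e → i ≡ j
  nth-injective {x ∷ xs} {zero}  {zero}  _ _ _ _ = refl
  nth-injective {x ∷ xs} {zero}  {suc j} (x∉ ∷ _) _ (s≤s j<) eq =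
    contradiction eq (All.lookup x∉ (nth-∈ xs j<))
  nth-injective {x ∷ xs} {suc i} {zero}  (x∉ ∷ _) (s≤s i<) _ eq =
    contradiction (sym eq) (All.lookup x∉ (nth-∈ xs i<))
  nth-injective {x ∷ xs} {suc i} {suc j} (_ ∷ xs!) (s≤s i<) (s≤s j<) eq =
    cong suc (nth-injective xs! i< j< eq)

  nth-ext : ∀ (xs ys : List A) → length xs ≡ length ys →
            (∀ i → i < length xs → ∃₂ λ d e → nth xs i d ≡ nth ys i e) → xs ≡ ys
  nth-ext []       []       _   _ = refl
  nth-ext (x ∷ xs) (y ∷ ys) len h = cong₂ _∷_ (proj₂ (proj₂ (h 0 (s≤s z≤n))))
    (nth-ext xs ys (suc-injective len) (λ i i< → h (suc i) (s≤s i<)))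

-- The default `i` makes this total for every `τ`; it is never reached when `τ` is a permutation.
apply : ∀ {n} → List (Fin n) → Fin n → Fin n
apply τ i = nth τ (toℕ i) i

module _ {n : ℕ} {τ : List (Fin n)} (τ∈ : τ ∈ permutations n) where

  private
    in-range : ∀ i → toℕ i < length τ
    in-range i = subst (toℕ i <_) (sym (proj₂ (∈-permutations⁻ τ∈))) (Fin.toℕ<n i)

  apply-injective : ∀ {i j} → apply τ i ≡ apply τ j → i ≡ j
  apply-injective {i} {j} eq = Fin.toℕ-injective
    (nth-injective (proj₁ (∈-permutations⁻ τ∈)) (in-range i) (in-range j) eq)

map≡⇒≗ : ∀ {A B : Set} {f g : A → B} xs → map f xs ≡ map g xs → ∀ {x} → x ∈ xs → f x ≡ g x
map≡⇒≗ (x ∷ xs) eq (here refl) = List.∷-injectiveˡ eq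
map≡⇒≗ (x ∷ xs) eq (there x∈)  = map≡⇒≗ xs (List.∷-injectiveʳ eq) x∈

-- Precomposing with `κ` permutes the permutations: since `κ` lists every label, the values of `τ`
-- along `κ` determine `τ`.
∑-permutations-∘ : ∀ {n} {κ : List (Fin n)} → Unique κ → length κ ≡ n → (∀ i → i ∈ κ) → ∀ f →
                   ∑ (permutations n) (λ τ → f (map (apply τ) κ)) ≡ ∑ (permutations n) f
∑-permutations-∘ {n} {κ} κ! len complete f =
  ∑-reindex f (λ τ → map (apply τ) κ) (arrangements-unique ⊤)
    (λ {τ} τ∈ → ∈-permutations⁺ (Unique.map⁺ (apply-injective τ∈) κ!)
                  (trans (List.length-map (apply τ) κ) len))
    (λ {τ} {τ′} τ∈ τ′∈ eq →
      let len₁ = proj₂ (∈-permutations⁻ τ∈) ; len₂ = proj₂ (∈-permutations⁻ τ′∈) in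
      nth-ext τ τ′ (trans len₁ (sym len₂)) λ i i< →
        let j = fromℕ< (subst (i <_) len₁ i<) in
        j , j , subst (λ k → nth τ k j ≡ nth τ′ k j) (Fin.toℕ-fromℕ< (subst (i <_) len₁ i<))
                  (map≡⇒≗ κ eq (complete j)))

-- Ranks of lists

fromList : ∀ {n} → List (Fin n) → Subset n
fromList []       = ⊥
fromList (x ∷ xs) = ⁅ x ⁆ ∪ fromList xs

∈-fromList⁺ : ∀ {n} {xs : List (Fin n)} {x} → x ∈ xs → x ∈ˢ fromList xs
∈-fromList⁺ {xs = x ∷ xs} (here refl) = x∈p∪q⁺ (inj₁ (x∈⁅x⁆ x))
∈-fromList⁺ {xs = x ∷ xs} (there x∈)  = x∈p∪q⁺ {p = ⁅ x ⁆} (inj₂ (∈-fromList⁺ x∈))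

∈-fromList⁻ : ∀ {n} (xs : List (Fin n)) {x} → x ∈ˢ fromList xs → x ∈ xs
∈-fromList⁻ []       x∈ = contradiction x∈ ∉⊥
∈-fromList⁻ (y ∷ xs) x∈ with x∈p∪q⁻ ⁅ y ⁆ (fromList xs) x∈
... | inj₁ x∈y = here (x∈⁅y⁆⇒x≡y y x∈y)
... | inj₂ x∈xs = there (∈-fromList⁻ xs x∈xs)

fromList-mono : ∀ {n} {xs ys : List (Fin n)} → xs ⊆ ys → fromList xs ⊆ˢ fromList ys
fromList-mono {xs = xs} xs⊆ys x∈ = ∈-fromList⁺ (xs⊆ys (∈-fromList⁻ xs x∈))

fromList-∷ʳ : ∀ {n} (xs : List (Fin n)) x → fromList (xs ∷ʳ x) ≡ fromList xs ∪ ⁅ x ⁆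
fromList-∷ʳ xs x = ⊆-antisym
  (λ y∈ → [ (λ y∈xs → x∈p∪q⁺ (inj₁ (∈-fromList⁺ y∈xs)))
          , (λ { (here refl) → x∈p∪q⁺ {p = fromList xs} (inj₂ (x∈⁅x⁆ x)) }) ]′
          (∈-++⁻ xs (∈-fromList⁻ (xs ∷ʳ x) y∈)))
  (λ y∈ → [ (λ y∈xs → ∈-fromList⁺ (∈-++⁺ˡ (∈-fromList⁻ xs y∈xs)))
          , (λ y∈x → ∈-fromList⁺ (∈-++⁺ʳ xs (here (x∈⁅y⁆⇒x≡y x y∈x)))) ]′
          (x∈p∪q⁻ (fromList xs) ⁅ x ⁆ y∈))

module _ {n : ℕ} (M : Matroid n) where

  r-unit : ∀ X e → r M (X ∪ ⁅ e ⁆) ≤ suc (r M X)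
  r-unit X e = begin
    r M (X ∪ ⁅ e ⁆)                     ≤⟨ m≤m+n _ _ ⟩
    r M (X ∪ ⁅ e ⁆) + r M (X ∩ ⁅ e ⁆)   ≤⟨ R3 M X ⁅ e ⁆ ⟩
    r M X + r M ⁅ e ⁆                   ≤⟨ +-monoʳ-≤ (r M X) (R1 M ⁅ e ⁆) ⟩
    r M X + ∣ ⁅ e ⁆ ∣                   ≡⟨ cong (r M X +_) (∣⁅x⁆∣≡1 e) ⟩
    r M X + 1                           ≡⟨ +-comm (r M X) 1 ⟩
    suc (r M X)                         ∎
    where open ≤-Reasoning

  r-cover : ∀ {Y} Z cs → (∀ {x} → x ∈ˢ Y → x ∈ˢ Z ⊎ x ∈ cs) → r M Y ≤ r M Z + length cs
  r-cover Z [] h = ≤-trans (R2 M _ _ (λ x∈ → [ id , (λ ()) ]′ (h x∈))) (m≤m+n _ 0)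
  r-cover {Y} Z (c ∷ cs) h = begin
    r M Y                         ≤⟨ r-cover (Z ∪ ⁅ c ⁆) cs (λ x∈ →
                                       [ (λ x∈Z → inj₁ (x∈p∪q⁺ (inj₁ x∈Z)))
                                       , (λ { (here refl) → inj₁ (x∈p∪q⁺ {p = Z} (inj₂ (x∈⁅x⁆ c)))
                                            ; (there x∈cs) → inj₂ x∈cs }) ]′ (h x∈)) ⟩
    r M (Z ∪ ⁅ c ⁆) + length cs   ≤⟨ +-monoˡ-≤ (length cs) (r-unit Z c) ⟩
    suc (r M Z) + length cs       ≡⟨ +-suc (r M Z) (length cs) ⟨
    r M Z + suc (length cs)       ∎
    where open ≤-Reasoning

  r-diminishing : ∀ {X Y} e → X ⊆ˢ Y → r M (Y ∪ ⁅ e ⁆) + r M X ≤ r M Y + r M (X ∪ ⁅ e ⁆)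
  r-diminishing {X} {Y} e X⊆Y = begin
    r M (Y ∪ ⁅ e ⁆) + r M X                          ≤⟨ +-mono-≤
      (R2 M _ _ λ x∈ → [ (λ x∈Y → x∈p∪q⁺ (inj₁ x∈Y))
                       , (λ x∈e → x∈p∪q⁺ {p = Y} (inj₂ (x∈p∪q⁺ {p = X} (inj₂ x∈e)))) ]′ (x∈p∪q⁻ Y ⁅ e ⁆ x∈))
      (R2 M _ _ λ x∈ → x∈p∩q⁺ (X⊆Y x∈ , x∈p∪q⁺ (inj₁ x∈))) ⟩
    r M (Y ∪ (X ∪ ⁅ e ⁆)) + r M (Y ∩ (X ∪ ⁅ e ⁆))    ≤⟨ R3 M Y (X ∪ ⁅ e ⁆) ⟩
    r M Y + r M (X ∪ ⁅ e ⁆)                          ∎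
    where open ≤-Reasoning

  rk : List (Fin n) → ℕ
  rk xs = r M (fromList xs)

  rk-mono : ∀ {xs ys} → xs ⊆ ys → rk xs ≤ rk ys
  rk-mono xs⊆ys = R2 M _ _ (fromList-mono xs⊆ys)

-- The properties of a rank function that survive pulling back along a relabelling. `mono` also
-- makes `ρ` blind to order and repetition, which matters because `support` may repeat elements.
record RankLike {A : Set} (ρ : List A → ℕ) : Set where
  field
    mono        : ∀ {xs ys} → xs ⊆ ys → ρ xs ≤ ρ ys
    unit        : ∀ xs x → ρ (xs ∷ʳ x) ≤ suc (ρ xs)
    diminishing : ∀ {xs ys} x → xs ⊆ ys → ρ (ys ∷ʳ x) + ρ xs ≤ ρ ys + ρ (xs ∷ʳ x)

module _ {n : ℕ} (M : Matroid n) {A : Set} (f : A → Fin n) where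

  private
    fromList-map-∷ʳ : ∀ xs x → fromList (map f (xs ∷ʳ x)) ≡ fromList (map f xs) ∪ ⁅ f x ⁆
    fromList-map-∷ʳ xs x = trans (cong fromList (List.map-++ f xs (x ∷ []))) (fromList-∷ʳ (map f xs) (f x))

    map-⊆ : ∀ {xs ys} → xs ⊆ ys → map f xs ⊆ map f ys
    map-⊆ {ys = ys} xs⊆ys y∈ with ∈-map⁻ f y∈
    ... | _ , x∈ , refl = ∈-map⁺ f (xs⊆ys x∈)

  rk-rankLike : RankLike (λ xs → rk M (map f xs))
  rk-rankLike = record
    { mono        = λ xs⊆ys → rk-mono M (map-⊆ xs⊆ys)
    ; unit        = λ xs x → subst (λ S → r M S ≤ suc (rk M (map f xs))) (sym (fromList-map-∷ʳ xs x))
                               (r-unit M (fromList (map f xs)) (f x))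
    ; diminishing = λ {xs} {ys} x xs⊆ys →
        subst₂ (λ S T → r M S + rk M (map f xs) ≤ rk M (map f ys) + r M T)
          (sym (fromList-map-∷ʳ ys x)) (sym (fromList-map-∷ʳ xs x))
          (r-diminishing M (f x) (fromList-mono (map-⊆ xs⊆ys)))
    }

-- Rank sequences as differences of prefix ranks

scan : ∀ {A : Set} → (List A → ℕ) → List A → List A → List ℕ
scan f acc []       = []
scan f acc (x ∷ xs) = f (acc ∷ʳ x) ∷ scan f (acc ∷ʳ x) xs

differences : ℕ → List ℕ → List ℕ
differences p []       = []
differences p (x ∷ xs) = (x ∸ p) ∷ differences x xs

module _ {n : ℕ} (M : Matroid n) where

  rankSeqFrom≡differences : ∀ acc xs → rankSeqFrom (r M) (fromList acc) xs ≡ differences (rk M acc) (scan (rk M) acc xs)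
  rankSeqFrom≡differences acc []       = refl
  rankSeqFrom≡differences acc (x ∷ xs) rewrite sym (fromList-∷ʳ acc x) =
    cong ((rk M (acc ∷ʳ x) ∸ rk M acc) ∷_) (rankSeqFrom≡differences (acc ∷ʳ x) xs)

  length-rankSeqFrom : ∀ X xs → length (rankSeqFrom (r M) X xs) ≡ length xs
  length-rankSeqFrom X []       = refl
  length-rankSeqFrom X (x ∷ xs) = cong suc (length-rankSeqFrom (X ∪ ⁅ x ⁆) xs)

  -- Telescoping; truncated subtraction does no harm because ranks never decrease along a list.
  rk-take : ∀ acc xs i → rk M (acc ++ take i xs) ≡ rk M acc + sum (take i (rankSeqFrom (r M) (fromList acc) xs))
  rk-take acc xs zero = trans (cong (rk M) (List.++-identityʳ acc)) (sym (+-identityʳ _))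
  rk-take acc [] (suc i) = trans (cong (rk M) (List.++-identityʳ acc)) (sym (+-identityʳ _))
  rk-take acc (x ∷ xs) (suc i) rewrite sym (fromList-∷ʳ acc x) = begin
    rk M (acc ++ x ∷ take i xs)         ≡⟨ cong (rk M) (List.++-assoc acc (x ∷ []) (take i xs)) ⟨
    rk M ((acc ∷ʳ x) ++ take i xs)      ≡⟨ rk-take (acc ∷ʳ x) xs i ⟩
    rk M (acc ∷ʳ x) + rest              ≡⟨ cong (_+ rest) (m+[n∸m]≡n (rk-mono M {acc} {acc ∷ʳ x} ∈-++⁺ˡ)) ⟨
    rk M acc + (rk M (acc ∷ʳ x) ∸ rk M acc) + rest ≡⟨ +-assoc (rk M acc) _ rest ⟩
    rk M acc + ((rk M (acc ∷ʳ x) ∸ rk M acc) + rest) ∎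
    where
    open ≡-Reasoning
    rest = sum (take i (rankSeqFrom (r M) (fromList (acc ∷ʳ x)) xs))

  r⊥≡0 : r M ⊥ ≡ 0
  r⊥≡0 = n≤0⇒n≡0 (≤-trans (R1 M ⊥) (≤-reflexive (∣⊥∣≡0 n)))

-- Averaging over permutations

ranks : ∀ {n} → Matroid n → List (Fin n) → List (Fin n) → ℕ
ranks M τ xs = rk M (map (apply τ) xs)

-- `g` reads `ρ` only on the chain of prefixes of `k`, taken as sets: mutual inclusion stands in for
-- equality so that `l` may reorder or repeat elements.
DeterminedBy : ∀ {n} → List (Fin n) → ((List (Fin n) → ℕ) → ℕ) → Set
DeterminedBy k g = ∀ ρ ρ′ → (∀ l p q → k ≡ p ++ q → l ⊆ p → p ⊆ l → ρ l ≡ ρ′ l) → g ρ ≡ g ρ′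

take-length-++ : ∀ {A : Set} (xs ys : List A) → take (length xs) (xs ++ ys) ≡ xs
take-length-++ []       ys = refl
take-length-++ (x ∷ xs) ys = cong (x ∷_) (take-length-++ xs ys)

module _ {n : ℕ} where

  private
    dedup : List (Fin n) → List (Fin n)
    dedup = insertAll Fin._≟_ []

    dedup-⊇ : ∀ xs → xs ⊆ dedup xs
    dedup-⊇ = insertAll-⊇ Fin._≟_ []

    dedup-⊆ : ∀ xs → dedup xs ⊆ xs
    dedup-⊆ = insertAll-⊆ Fin._≟_ []

    dedup-unique : ∀ xs → Unique (dedup xs)
    dedup-unique xs = insertAll-unique Fin._≟_ xs []

    length-dedup-mono : ∀ {xs ys} → xs ⊆ ys → length (dedup xs) ≤ length (dedup ys)
    length-dedup-mono {xs} {ys} xs⊆ys =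
      unique⇒length≤ (dedup-unique xs) (dedup-⊇ ys ∘ xs⊆ys ∘ dedup-⊆ xs)

    prefixRank : List ℕ → List (Fin n) → ℕ
    prefixRank s l = sum (take (length (dedup l)) s)

  -- The permutation listing k by first occurrences, followed by the missing elements.
  completion : List (Fin n) → List (Fin n)
  completion k = dedup (k ++ allFin n)

  completion-complete : ∀ k i → i ∈ completion k
  completion-complete k i = dedup-⊇ (k ++ allFin n) (∈-++⁺ʳ k (∈-allFin i))

  length-completion : ∀ k → length (completion k) ≡ n
  length-completion k = ≤-antisym
    (≤-trans (unique⇒length≤ (dedup-unique (k ++ allFin n)) (λ {i} _ → ∈-allFin i))
             (≤-reflexive (List.length-tabulate {n = n} id)))
    (≤-trans (≤-reflexive (sym (List.length-tabulate {n = n} id)))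
             (unique⇒length≤ (Unique.allFin⁺ n) (λ {i} _ → completion-complete k i)))

  -- The distinct elements of `p` form an initial segment of the completion, and there are as many
  -- of them as distinct elements of `l`. The rank sequence summed up to there is the rank.
  ranks≡prefixRank : ∀ (M : Matroid n) τ l p q → l ⊆ p → p ⊆ l →
    ranks M τ l ≡ prefixRank (rankSeq (r M) (map (apply τ) (completion (p ++ q)))) l
  ranks≡prefixRank M τ l p q l⊆p p⊆l = begin
    ranks M τ l                               ≡⟨ ≤-antisym (mono (dedup-⊇ p ∘ l⊆p)) (mono (p⊆l ∘ dedup-⊆ p)) ⟩
    ranks M τ (dedup p)                       ≡⟨ cong (ranks M τ) κ-prefix ⟨
    ranks M τ (take i κ)                      ≡⟨ cong (rk M) (List.take-map i κ) ⟨
    rk M (take i (map (apply τ) κ))           ≡⟨ rk-take M [] (map (apply τ) κ) i ⟩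
    rk M [] + sum (take i s)                  ≡⟨ cong (_+ sum (take i s)) (r⊥≡0 M) ⟩
    sum (take i s)                            ≡⟨ cong (λ j → sum (take j s))
                                                   (≤-antisym (length-dedup-mono p⊆l) (length-dedup-mono l⊆p)) ⟩
    prefixRank s l                            ∎
    where
    open ≡-Reasoning
    open RankLike (rk-rankLike M (apply τ)) using (mono)
    κ = completion (p ++ q)
    s = rankSeq (r M) (map (apply τ) κ)
    i = length (dedup p)
    -- The left fold over `p ++ q` passes through `dedup p` and afterwards only appends.
    κ-prefix : take i κ ≡ dedup p
    κ-prefix with insertAll-extends Fin._≟_ (dedup p) (q ++ allFin n)
    ... | ext , eq = trans (cong (take i) (trans (cong dedup (List.++-assoc p q (allFin n)))
                       (trans (List.foldl-++ (insert Fin._≟_) [] p (q ++ allFin n)) eq)))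
                       (take-length-++ (dedup p) ext)

  module _ (M N : Matroid n) (G≡ : ∀ s → G M s ≡ G N s) where

    -- Equal `G` means that the rank sequences of all permutations form the same multiset.
    ∑-rankSeq : ∀ (h : List ℕ → ℕ) →
                ∑ (permutations n) (h ∘ rankSeq (r M)) ≡ ∑ (permutations n) (h ∘ rankSeq (r N))
    ∑-rankSeq h = trans (sym (∑-map h (rankSeq (r M)) (permutations n)))
      (trans (∑-↭ h (counts≡⇒↭ _≟ᴸ_ (map (rankSeq (r M)) (permutations n)) (map (rankSeq (r N)) (permutations n)) counts≡))
             (∑-map h (rankSeq (r N)) (permutations n)))
      where
      count-rankSeq : ∀ (L : Matroid n) s → count _≟ᴸ_ s (map (rankSeq (r L)) (permutations n)) ≡ G L s
      count-rankSeq L s = trans (∑-map _ (rankSeq (r L)) (permutations n)) (sym (GRestr-∑ L ⊤ s))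
      counts≡ : ∀ s → count _≟ᴸ_ s (map (rankSeq (r M)) (permutations n))
                    ≡ count _≟ᴸ_ s (map (rankSeq (r N)) (permutations n))
      counts≡ s = trans (count-rankSeq M s) (trans (G≡ s) (sym (count-rankSeq N s)))

    -- What `g` reads are partial sums of the rank sequence of `τ` composed with the completion of
    -- `k`. That reordering depends on `k` alone, so it merely permutes the index set of the sum
    -- over `τ`.
    ∑-determined : ∀ k g → DeterminedBy k g →
                   ∑ (permutations n) (g ∘ ranks M) ≡ ∑ (permutations n) (g ∘ ranks N)
    ∑-determined k g det = trans (via M) (trans (∑-rankSeq h) (sym (via N)))
      where
      h : List ℕ → ℕ
      h s = g (prefixRank s)
      via : ∀ L → ∑ (permutations n) (g ∘ ranks L) ≡ ∑ (permutations n) (h ∘ rankSeq (r L))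
      via L = trans
        (∑-cong (permutations n) (λ {τ} _ → det _ _ λ l p q eq l⊆p p⊆l →
           subst (λ k → ranks L τ l ≡ prefixRank (rankSeq (r L) (map (apply τ) (completion k))) l)
                 (sym eq) (ranks≡prefixRank L τ l p q l⊆p p⊆l)))
        (∑-permutations-∘ (dedup-unique (k ++ allFin n)) (length-completion k) (completion-complete k)
           (h ∘ rankSeq (r L)))

-- The cone over a rank function

data Elt (n m : ℕ) : Set where
  base : Fin n → Elt n m
  copy : Fin n → Fin m → Elt n m
  tip  : Elt n m

module _ {n m : ℕ} where

  bases : List (Elt n m) → List (Fin n)
  bases []               = []
  bases (base e   ∷ xs)  = e ∷ bases xs
  bases (copy _ _ ∷ xs)  = bases xs
  bases (tip      ∷ xs)  = bases xs

  copied : List (Elt n m) → List (Fin n)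
  copied []              = []
  copied (base _   ∷ xs) = copied xs
  copied (copy e _ ∷ xs) = e ∷ copied xs
  copied (tip      ∷ xs) = copied xs

  support : List (Elt n m) → List (Fin n)
  support []              = []
  support (base e   ∷ xs) = e ∷ support xs
  support (copy e _ ∷ xs) = e ∷ support xs
  support (tip      ∷ xs) = support xs

  nonbase : List (Elt n m) → List (Elt n m)
  nonbase []              = []
  nonbase (base _   ∷ xs) = nonbase xs
  nonbase (copy e j ∷ xs) = copy e j ∷ nonbase xs
  nonbase (tip      ∷ xs) = tip ∷ nonbase xs

  bases-++ : ∀ xs ys → bases (xs ++ ys) ≡ bases xs ++ bases ys
  bases-++ []              ys = refl
  bases-++ (base e   ∷ xs) ys = cong (e ∷_) (bases-++ xs ys)
  bases-++ (copy _ _ ∷ xs) ys = bases-++ xs ys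
  bases-++ (tip      ∷ xs) ys = bases-++ xs ys

  support-++ : ∀ xs ys → support (xs ++ ys) ≡ support xs ++ support ys
  support-++ []              ys = refl
  support-++ (base e   ∷ xs) ys = cong (e ∷_) (support-++ xs ys)
  support-++ (copy e _ ∷ xs) ys = cong (e ∷_) (support-++ xs ys)
  support-++ (tip      ∷ xs) ys = support-++ xs ys

  nonbase-++ : ∀ xs ys → nonbase (xs ++ ys) ≡ nonbase xs ++ nonbase ys
  nonbase-++ []              ys = refl
  nonbase-++ (base _   ∷ xs) ys = nonbase-++ xs ys
  nonbase-++ (copy e j ∷ xs) ys = cong (copy e j ∷_) (nonbase-++ xs ys)
  nonbase-++ (tip      ∷ xs) ys = cong (tip ∷_) (nonbase-++ xs ys)

  support-↭ : ∀ xs → support xs ↭ bases xs ++ copied xs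
  support-↭ []              = ↭-refl
  support-↭ (base e   ∷ xs) = prep e (support-↭ xs)
  support-↭ (copy e _ ∷ xs) = ↭-trans (prep e (support-↭ xs)) (↭-sym (Perm.shift e (bases xs) (copied xs)))
  support-↭ (tip      ∷ xs) = support-↭ xs

  bases⊆support : ∀ xs → bases xs ⊆ support xs
  bases⊆support xs x∈ = Perm.∈-resp-↭ (↭-sym (support-↭ xs)) (∈-++⁺ˡ x∈)

  -- In a free cone, X has rank min (r (X ∩ E) + |X - E|) (r (support X) + 1).
  low high coneRank : (List (Fin n) → ℕ) → List (Elt n m) → ℕ
  low      ρ xs = ρ (bases xs) + length (nonbase xs)
  high     ρ xs = suc (ρ (support xs))
  coneRank ρ xs = low ρ xs ⊓ high ρ xs

  -- Where this fails, `low` is at least `high`; the condition therefore decides which term of the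
  -- minimum is the rank.
  Tight : (List (Fin n) → ℕ) → List (Elt n m) → Set
  Tight ρ xs = low ρ xs ≤ ρ (support xs)

  tight? : ∀ ρ xs → Dec (Tight ρ xs)
  tight? ρ xs = low ρ xs ≤? ρ (support xs)

scan-++ : ∀ {A : Set} (f : List A → ℕ) acc xs ys → scan f acc (xs ++ ys) ≡ scan f acc xs ++ scan f (acc ++ xs) ys
scan-++ f acc []       ys = cong (λ a → scan f a ys) (sym (List.++-identityʳ acc))
scan-++ f acc (x ∷ xs) ys = cong (f (acc ∷ʳ x) ∷_) (trans (scan-++ f (acc ∷ʳ x) xs ys)
  (cong (λ a → scan f (acc ∷ʳ x) xs ++ scan f a ys) (List.++-assoc acc (x ∷ []) xs)))

scan-cong : ∀ {A : Set} {f g : List A → ℕ} acc xs →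
            (∀ p q → xs ≡ p ++ q → f (acc ++ p) ≡ g (acc ++ p)) → scan f acc xs ≡ scan g acc xs
scan-cong acc []       h = refl
scan-cong {f = f} {g} acc (x ∷ xs) h = cong₂ _∷_ (h (x ∷ []) xs refl)
  (scan-cong (acc ∷ʳ x) xs λ p q eq →
    subst (λ l → f l ≡ g l) (sym (List.++-assoc acc (x ∷ []) p)) (h (x ∷ p) q (cong (x ∷_) eq)))

-- Tight prefixes and the switch from `low` to `high`

module _ {n m : ℕ} {ρ : List (Fin n) → ℕ} (ρ-rank : RankLike ρ) where

  open RankLike ρ-rank

  -- A copy adds 1 to `low` and at most 1 to the rank of the support; the tip adds 1 to `low` and
  -- leaves the support alone; a base element raises the rank of `bases xs` at least as much as that
  -- of the larger `support xs`, by submodularity.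
  tight-init : ∀ (xs : List (Elt n m)) x → Tight ρ (xs ∷ʳ x) → Tight ρ xs
  tight-init xs (base e) t
    rewrite bases-++ xs (base e ∷ []) | support-++ xs (base e ∷ []) | nonbase-++ xs (base e ∷ [])
          | List.++-identityʳ (nonbase xs) = +-cancelˡ-≤ (ρ (bases xs ∷ʳ e)) _ _ (begin
      ρ (bases xs ∷ʳ e) + (ρ (bases xs) + c) ≡⟨ x∙yz≈xz∙y +-commutativeSemigroup (ρ (bases xs ∷ʳ e)) (ρ (bases xs)) c ⟩
      ρ (bases xs ∷ʳ e) + c + ρ (bases xs)   ≤⟨ +-monoˡ-≤ (ρ (bases xs)) t ⟩
      ρ (support xs ∷ʳ e) + ρ (bases xs)     ≤⟨ diminishing e (bases⊆support xs) ⟩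
      ρ (support xs) + ρ (bases xs ∷ʳ e)     ≡⟨ +-comm (ρ (support xs)) _ ⟩
      ρ (bases xs ∷ʳ e) + ρ (support xs)     ∎)
    where
    open ≤-Reasoning
    c = length (nonbase xs)
  tight-init xs (copy e j) t
    rewrite bases-++ xs (copy e j ∷ []) | support-++ xs (copy e j ∷ []) | nonbase-++ xs (copy e j ∷ [])
          | List.++-identityʳ (bases xs) | List.length-++ (nonbase xs) {copy e j ∷ []}
          | +-comm (length (nonbase xs)) 1 | +-suc (ρ (bases xs)) (length (nonbase xs)) =
      s≤s⁻¹ (≤-trans t (unit (support xs) e))
  tight-init xs tip t
    rewrite bases-++ xs (tip ∷ []) | support-++ xs (tip ∷ []) | nonbase-++ xs (tip ∷ [])
          | List.++-identityʳ (bases xs) | List.++-identityʳ (support xs)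
          | List.length-++ (nonbase xs) {tip ∷ []} = ≤-trans (+-monoʳ-≤ (ρ (bases xs)) (m≤m+n _ 1)) t

  tight-prefix : ∀ (xs ys : List (Elt n m)) → Tight ρ (xs ++ ys) → Tight ρ xs
  tight-prefix xs []       t = subst (Tight ρ) (List.++-identityʳ xs) t
  tight-prefix xs (y ∷ ys) t = tight-init xs y
    (tight-prefix (xs ∷ʳ y) ys (subst (Tight ρ) (sym (List.++-assoc xs (y ∷ []) ys)) t))

  scan-tight : ∀ xs → Tight ρ xs → scan (coneRank ρ) [] xs ≡ scan (low {n} {m} ρ) [] xs
  scan-tight xs t = scan-cong [] xs λ p q eq →
    m≤n⇒m⊓n≡m (m≤n⇒m≤1+n (tight-prefix p q (subst (Tight ρ) eq t)))

  scan-loose : ∀ xs x ys → ¬ Tight ρ (xs ∷ʳ x) → scan (coneRank ρ) xs (x ∷ ys) ≡ scan (high {n} {m} ρ) xs (x ∷ ys)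
  scan-loose xs x ys ¬t = cong₂ _∷_ (m≥n⇒m⊓n≡n (≰⇒> ¬t))
    (scan-cong {f = coneRank ρ} {high ρ} (xs ∷ʳ x) ys λ p _ _ →
       m≥n⇒m⊓n≡n (≰⇒> (¬t ∘ tight-prefix (xs ∷ʳ x) p)))

module _ {n m : ℕ} (h : List ℕ → ℕ) where

  tightSum : List (Elt n m) → List (Elt n m) → (List (Fin n) → ℕ) → ℕ
  tightSum xs ys ρ = 𝟙 (tight? ρ xs) * h (scan (coneRank ρ) [] (xs ++ ys))

  -- The list of ranks that would arise if the switch came right after `ys`, weighted by tightness
  -- of `xs`. Weight and switch point are separate arguments because `xs` is sometimes `ys` and
  -- sometimes `ys` with one more element.
  switchSum : List (Elt n m) → List (Elt n m) → List (Elt n m) → (List (Fin n) → ℕ) → ℕ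
  switchSum xs ys zs ρ = 𝟙 (tight? ρ xs) * h (scan (low ρ) [] ys ++ scan (high ρ) ys zs)

  tightSum-[] : ∀ {ρ} → RankLike ρ → ∀ xs → tightSum xs [] ρ ≡ switchSum xs xs [] ρ
  tightSum-[] {ρ} ρ-rank xs with tight? ρ xs
  ... | no _  = refl
  ... | yes t = cong (λ l → h l + 0) (trans (cong (scan (coneRank ρ) []) (List.++-identityʳ xs))
                  (trans (scan-tight ρ-rank xs t) (sym (List.++-identityʳ _))))

  -- If both prefixes are tight, the two tight sums agree and so do the two switch sums. If `x`
  -- destroys tightness, the switch comes exactly after `xs`, and the terms weighted by `xs ∷ʳ x`
  -- vanish.
  tightSum-∷ : ∀ {ρ} → RankLike ρ → ∀ xs x ys →
    tightSum xs (x ∷ ys) ρ + switchSum (xs ∷ʳ x) xs (x ∷ ys) ρ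
      ≡ switchSum xs xs (x ∷ ys) ρ + tightSum (xs ∷ʳ x) ys ρ
  tightSum-∷ {ρ} ρ-rank xs x ys with tight? ρ xs | tight? ρ (xs ∷ʳ x)
  ... | no _   | no _   = refl
  ... | no ¬t  | yes t′ = contradiction (tight-init ρ-rank xs x t′) ¬t
  ... | yes t  | yes _  = trans (+-comm (h (scan (coneRank ρ) [] (xs ++ x ∷ ys)) + 0) _)
    (cong (λ l → h (scan (low ρ) [] xs ++ scan (high ρ) xs (x ∷ ys)) + 0 + (h (scan (coneRank ρ) [] l) + 0))
          (sym (List.++-assoc xs (x ∷ []) ys)))
  ... | yes t  | no ¬t′ = cong (λ l → h l + 0 + 0) (trans (scan-++ (coneRank ρ) [] xs (x ∷ ys))
    (cong₂ _++_ (scan-tight ρ-rank xs t) (scan-loose ρ-rank xs x ys ¬t′)))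

  module _ (xs zs : List (Elt n m)) {ρ ρ′ : List (Fin n) → ℕ}
           (agree : ∀ l p q → (bases xs ++ copied xs) ++ support zs ≡ p ++ q → l ⊆ p → p ⊆ l → ρ l ≡ ρ′ l) where

    agree-low : ∀ p q → xs ≡ p ++ q → low ρ p ≡ low ρ′ p
    agree-low p q eq = cong (_+ length (nonbase p)) (agree (bases p) (bases p)
      ((bases q ++ copied xs) ++ support zs)
      (trans (cong (λ l → (l ++ copied xs) ++ support zs) (trans (cong bases eq) (bases-++ p q)))
        (trans (cong (_++ support zs) (List.++-assoc (bases p) (bases q) (copied xs)))
               (List.++-assoc (bases p) (bases q ++ copied xs) (support zs)))) id id)

    agree-support : ∀ p q → zs ≡ p ++ q → ρ (support (xs ++ p)) ≡ ρ′ (support (xs ++ p))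
    agree-support p q eq = agree (support (xs ++ p)) ((bases xs ++ copied xs) ++ support p) (support q)
      (trans (cong ((bases xs ++ copied xs) ++_) (trans (cong support eq) (support-++ p q)))
        (sym (List.++-assoc (bases xs ++ copied xs) (support p) (support q))))
      (λ x∈ → Perm.∈-resp-↭ perm x∈) (λ x∈ → Perm.∈-resp-↭ (↭-sym perm) x∈)
      where
      perm : support (xs ++ p) ↭ (bases xs ++ copied xs) ++ support p
      perm = subst (_↭ (bases xs ++ copied xs) ++ support p) (sym (support-++ xs p)) (Perm.++⁺ʳ (support p) (support-↭ xs))

    agree-tight : 𝟙 (tight? ρ xs) ≡ 𝟙 (tight? ρ′ xs)
    agree-tight = cong₂ (λ a b → 𝟙 (a ≤? b)) (agree-low xs [] (sym (List.++-identityʳ xs)))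
      (subst (λ l → ρ (support l) ≡ ρ′ (support l)) (List.++-identityʳ xs) (agree-support [] zs refl))

  switchSum-determined : ∀ xs zs → DeterminedBy ((bases xs ++ copied xs) ++ support zs) (switchSum xs xs zs)
  switchSum-determined xs zs ρ ρ′ agree = cong₂ _*_ (agree-tight xs zs agree)
    (cong h (cong₂ _++_ (scan-cong [] xs (agree-low xs zs agree))
                        (scan-cong xs zs (λ p q eq → cong suc (agree-support xs zs agree p q eq)))))

  -- The chain runs through `bases (xs ∷ʳ x)` and may miss the set `support xs`. This is harmless:
  -- `scan` evaluates `high` for the first time once `x` has been added.
  switchSum-∷-determined : ∀ xs x zs → DeterminedBy ((bases (xs ∷ʳ x) ++ copied (xs ∷ʳ x)) ++ support zs)
                                                    (switchSum (xs ∷ʳ x) xs (x ∷ zs))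
  switchSum-∷-determined xs x zs ρ ρ′ agree = cong₂ _*_ (agree-tight (xs ∷ʳ x) zs agree)
    (cong h (cong₂ _++_
      (scan-cong [] xs (λ p q eq → agree-low (xs ∷ʳ x) zs agree p (q ∷ʳ x)
         (trans (cong (_∷ʳ x) eq) (List.++-assoc p q (x ∷ [])))))
      (cong₂ _∷_
        (cong suc (subst (λ l → ρ (support l) ≡ ρ′ (support l)) (List.++-identityʳ (xs ∷ʳ x))
          (agree-support (xs ∷ʳ x) zs agree [] zs refl)))
        (scan-cong (xs ∷ʳ x) zs (λ p q eq → cong suc (agree-support (xs ∷ʳ x) zs agree p q eq))))))

  module _ (M N : Matroid n) (G≡ : ∀ s → G M s ≡ G N s) where

    -- Counts by the position where low first exceeds the rank of the support; whether the
    -- switch happens exactly at a given x is not a function of prefix ranks,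
    -- but it is the difference of two quantities that are.
    ∑-tightSum : ∀ ys xs → ∑ (permutations n) (tightSum xs ys ∘ ranks M)
                         ≡ ∑ (permutations n) (tightSum xs ys ∘ ranks N)
    ∑-tightSum [] xs = trans (via M) (trans
      (∑-determined M N G≡ _ (switchSum xs xs []) (switchSum-determined xs [])) (sym (via N)))
      where
      via : ∀ L → ∑ (permutations n) (tightSum xs [] ∘ ranks L) ≡ ∑ (permutations n) (switchSum xs xs [] ∘ ranks L)
      via L = ∑-cong (permutations n) (λ {τ} _ → tightSum-[] (rk-rankLike L (apply τ)) xs)
    ∑-tightSum (x ∷ ys) xs = +-cancelʳ-≡ (∑ P (T′ ∘ ranks N)) _ _ (begin
      ∑ P (U ∘ ranks M) + ∑ P (T′ ∘ ranks N)  ≡⟨ cong (∑ P (U ∘ ranks M) +_)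
        (∑-determined M N G≡ _ T′ (switchSum-∷-determined xs x ys)) ⟨
      ∑ P (U ∘ ranks M) + ∑ P (T′ ∘ ranks M)  ≡⟨ split M ⟩
      ∑ P (T ∘ ranks M) + ∑ P (U′ ∘ ranks M)  ≡⟨ cong₂ _+_
        (∑-determined M N G≡ _ T (switchSum-determined xs (x ∷ ys))) (∑-tightSum ys (xs ∷ʳ x)) ⟩
      ∑ P (T ∘ ranks N) + ∑ P (U′ ∘ ranks N)  ≡⟨ split N ⟨
      ∑ P (U ∘ ranks N) + ∑ P (T′ ∘ ranks N)  ∎)
      where
      open ≡-Reasoning
      P  = permutations n
      U  = tightSum xs (x ∷ ys)
      U′ = tightSum (xs ∷ʳ x) ys
      T  = switchSum xs xs (x ∷ ys)
      T′ = switchSum (xs ∷ʳ x) xs (x ∷ ys)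
      split : ∀ L → ∑ P (U ∘ ranks L) + ∑ P (T′ ∘ ranks L) ≡ ∑ P (T ∘ ranks L) + ∑ P (U′ ∘ ranks L)
      split L = trans (sym (∑-distrib-+ (U ∘ ranks L) (T′ ∘ ranks L) P)) (trans
        (∑-cong P (λ {τ} _ → tightSum-∷ (rk-rankLike L (apply τ)) xs x ys))
        (∑-distrib-+ (T ∘ ranks L) (U′ ∘ ranks L) P))

    ∑-coneRank : ∀ xs → ∑ (permutations n) (λ τ → h (scan (coneRank (ranks M τ)) [] xs))
                      ≡ ∑ (permutations n) (λ τ → h (scan (coneRank (ranks N τ)) [] xs))
    ∑-coneRank xs = trans (via M) (trans (∑-tightSum xs []) (sym (via N)))
      where
      initial : ∀ (ρ : List (Fin n) → ℕ) → h (scan (coneRank ρ) [] xs) ≡ tightSum [] xs ρ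
      initial ρ with tight? {m = m} ρ []
      ... | yes _ = sym (+-identityʳ _)
      ... | no ¬t = contradiction (≤-reflexive (+-identityʳ (ρ []))) ¬t
      via : ∀ L → ∑ (permutations n) (λ τ → h (scan (coneRank (ranks L τ)) [] xs))
                ≡ ∑ (permutations n) (tightSum [] xs ∘ ranks L)
      via L = ∑-cong (permutations n) (λ {τ} _ → initial (ranks L τ))

-- Cyclic flats and the rank function of a free cone

x∉p-x : ∀ {n} (p : Subset n) x → x ∉ˢ p - x
x∉p-x (_ ∷ p) zero    ()
x∉p-x (_ ∷ p) (suc x) (there x∈) = x∉p-x p x x∈

module _ {n : ℕ} (M : Matroid n) where

  private
    add-cyclic : ∀ {C e} → e ∉ˢ C → r M (C ∪ ⁅ e ⁆) ≤ r M C → IsCyclic M C → IsCyclic M (C ∪ ⁅ e ⁆)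
    add-cyclic {C} {e} e∉C le cyc f f∈ = ≤-antisym (R2 M _ _ (p─q⊆p (C ∪ ⁅ e ⁆) ⁅ f ⁆))
      (≤-trans le ([ old , new ]′ (x∈p∪q⁻ C ⁅ e ⁆ f∈)))
      where
      old : f ∈ˢ C → r M C ≤ r M ((C ∪ ⁅ e ⁆) - f)
      old f∈C = ≤-trans (≤-reflexive (sym (cyc f f∈C))) (R2 M _ _ λ x∈ →
        x∈p∧x≢y⇒x∈p-y (x∈p∪q⁺ (inj₁ (p─q⊆p C ⁅ f ⁆ x∈))) λ { refl → x∉p-x C f x∈ })
      new : f ∈ˢ ⁅ e ⁆ → r M C ≤ r M ((C ∪ ⁅ e ⁆) - f)
      new f∈e = R2 M _ _ λ x∈ → x∈p∧x≢y⇒x∈p-y (x∈p∪q⁺ (inj₁ x∈))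
        λ { refl → e∉C (subst (_∈ˢ C) (x∈⁅y⁆⇒x≡y e f∈e) x∈) }

    -- `k` is fuel bounding the number of elements outside `C`. An added element leaves the rank
    -- unchanged, so it is spanned by the rest and no coloop arises. Cyclicity is an implication so
    -- that sets with coloops can be closed too.
    closure′ : ∀ k C → n ≤ ∣ C ∣ + k →
      ∃ λ Z → C ⊆ˢ Z × IsFlat M Z × r M Z ≤ r M C × (IsCyclic M C → IsCyclic M Z)
    closure′ k C n≤ with Fin.any? (λ e → ¬? (e ∈? C) ×-dec (r M (C ∪ ⁅ e ⁆) ≤? r M C))
    ... | no ¬∃ = C , id , (λ e e∉ → ≰⇒> λ le → ¬∃ (e , e∉ , le)) , ≤-refl , id
    ... | yes (e , e∉ , le) = grow k n≤
      where
      C<C∪e : ∣ C ∣ < ∣ C ∪ ⁅ e ⁆ ∣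
      C<C∪e = p⊂q⇒∣p∣<∣q∣ (p⊆p∪q ⁅ e ⁆ , e , x∈p∪q⁺ {p = C} (inj₂ (x∈⁅x⁆ e)) , e∉)
      grow : ∀ k → n ≤ ∣ C ∣ + k →
        ∃ λ Z → C ⊆ˢ Z × IsFlat M Z × r M Z ≤ r M C × (IsCyclic M C → IsCyclic M Z)
      grow zero n≤ = contradiction (≤-trans C<C∪e (∣p∣≤n (C ∪ ⁅ e ⁆)))
        (≤⇒≯ (≤-trans n≤ (≤-reflexive (+-identityʳ ∣ C ∣))))
      grow (suc k) n≤ with closure′ k (C ∪ ⁅ e ⁆) (≤-trans n≤
        (≤-trans (≤-reflexive (+-suc ∣ C ∣ k)) (+-monoˡ-≤ k C<C∪e)))
      ... | Z , ⊆Z , flat , r≤ , cyc =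
        Z , ⊆Z ∘ p⊆p∪q ⁅ e ⁆ , flat , ≤-trans r≤ le , cyc ∘ add-cyclic e∉ le

  closure : ∀ C → ∃ λ Z → C ⊆ˢ Z × IsFlat M Z × r M Z ≤ r M C × (IsCyclic M C → IsCyclic M Z)
  closure C = closure′ n C (m≤n+m n ∣ C ∣)

  -- Coloops are removed one at a time. Each removal costs at least one unit of rank, so the rank
  -- serves as fuel and also pays for the length of `cs`.
  cyclicPart : ∀ k Y → r M Y ≤ k → ∃₂ λ C cs →
    IsCyclic M C × (∀ {x} → x ∈ˢ Y → x ∈ˢ C ⊎ x ∈ cs) × r M C + length cs ≤ r M Y
  cyclicPart k Y r≤k with Fin.any? (λ e → (e ∈? Y) ×-dec (r M (Y - e) <? r M Y))
  ... | no ¬∃ = Y , [] ,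
    (λ e e∈ → ≤-antisym (R2 M _ _ (p─q⊆p Y ⁅ e ⁆)) (≮⇒≥ λ lt → ¬∃ (e , e∈ , lt))) ,
    inj₁ , ≤-reflexive (+-identityʳ _)
  cyclicPart zero    Y r≤k | yes (e , _ , lt) = contradiction (≤-trans lt r≤k) λ ()
  cyclicPart (suc k) Y r≤k | yes (e , _ , lt) with cyclicPart k (Y - e) (s≤s⁻¹ (≤-trans lt r≤k))
  ... | C , cs , cyc , cover , le = C , e ∷ cs , cyc , cover′ ,
        ≤-trans (≤-reflexive (+-suc (r M C) (length cs))) (≤-trans (s≤s le) lt)
    where
    cover′ : ∀ {x} → x ∈ˢ Y → x ∈ˢ C ⊎ x ∈ e ∷ cs
    cover′ {x} x∈ with x Fin.≟ e
    ... | yes refl = inj₂ (here refl)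
    ... | no x≢e   = [ inj₁ , inj₂ ∘ there ]′ (cover (x∈p∧x≢y⇒x∈p-y x∈ x≢e))

  -- Together with r-cover: r Y = min { r Z + |Y - Z| : Z a cyclic flat }.
  cyclicFlat-cover : ∀ Y → ∃₂ λ Z cs →
    IsCyclicFlat M Z × (∀ {x} → x ∈ˢ Y → x ∈ˢ Z ⊎ x ∈ cs) × r M Z + length cs ≤ r M Y
  cyclicFlat-cover Y with cyclicPart (r M Y) Y ≤-refl
  ... | C , cs , cyc , cover , le with closure C
  ... | Z , C⊆Z , flat , r≤ , cyc→ = Z , cs , (flat , cyc→ cyc) ,
        (λ x∈ → [ inj₁ ∘ C⊆Z , inj₂ ]′ (cover x∈)) , ≤-trans (+-monoˡ-≤ (length cs) r≤) le

-- The ground set of the cone and its relabellings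

module _ {n m : ℕ} where

  encode : Elt n m → Fin (coneSize n m)
  encode (base e)   = (e ↑ˡ (n * m)) ↑ˡ 1
  encode (copy e j) = (n ↑ʳ combine e j) ↑ˡ 1
  encode tip        = (n + n * m) ↑ʳ zero

  private
    decodeCopy : Fin n × Fin m → Elt n m
    decodeCopy (e , j) = copy e j

    decodeInner : Fin n ⊎ Fin (n * m) → Elt n m
    decodeInner (inj₁ e) = base e
    decodeInner (inj₂ y) = decodeCopy (remQuot m y)

    decodeOuter : Fin (n + n * m) ⊎ Fin 1 → Elt n m
    decodeOuter (inj₁ x) = decodeInner (splitAt n x)
    decodeOuter (inj₂ _) = tip

  decode : Fin (coneSize n m) → Elt n m
  decode x = decodeOuter (splitAt (n + n * m) x)

  decode-encode : ∀ z → decode (encode z) ≡ z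
  decode-encode (base e)
    rewrite Fin.splitAt-↑ˡ (n + n * m) (e ↑ˡ (n * m)) 1 | Fin.splitAt-↑ˡ n e (n * m) = refl
  decode-encode (copy e j)
    rewrite Fin.splitAt-↑ˡ (n + n * m) (n ↑ʳ combine e j) 1 | Fin.splitAt-↑ʳ n (n * m) (combine e j) =
      cong decodeCopy (Fin.remQuot-combine e j)
  decode-encode tip rewrite Fin.splitAt-↑ʳ (n + n * m) 1 zero = refl

  encode-decode : ∀ x → encode (decode x) ≡ x
  encode-decode x with splitAt (n + n * m) x in eq
  ... | inj₂ zero = Fin.splitAt⁻¹-↑ʳ {n + n * m} eq
  ... | inj₁ y with splitAt n y in eq′
  ...   | inj₁ e = trans (cong (_↑ˡ 1) (Fin.splitAt⁻¹-↑ˡ {n} eq′)) (Fin.splitAt⁻¹-↑ˡ {n + n * m} eq)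
  ...   | inj₂ w = trans (cong (λ v → (n ↑ʳ v) ↑ˡ 1) (Fin.combine-remQuot {n} m w))
                     (trans (cong (_↑ˡ 1) (Fin.splitAt⁻¹-↑ʳ {n} eq′)) (Fin.splitAt⁻¹-↑ˡ {n + n * m} eq))

  decode-injective : ∀ {x y} → decode x ≡ decode y → x ≡ y
  decode-injective {x} {y} eq = trans (sym (encode-decode x)) (trans (cong encode eq) (encode-decode y))

  module _ (A : Subset n) (B : Subset (n * m)) (c : Bool) where

    lookup-base : ∀ e → lookup ((A Vec.++ B) Vec.++ Vec.[ c ]) (encode (base e)) ≡ lookup A e
    lookup-base e = trans (Vec.lookup-++ˡ (A Vec.++ B) Vec.[ c ] (e ↑ˡ (n * m))) (Vec.lookup-++ˡ A B e)

    lookup-copy : ∀ e j → lookup ((A Vec.++ B) Vec.++ Vec.[ c ]) (encode (copy e j)) ≡ lookup B (combine e j)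
    lookup-copy e j = trans (Vec.lookup-++ˡ (A Vec.++ B) Vec.[ c ] (n ↑ʳ combine e j)) (Vec.lookup-++ʳ A B (combine e j))

    lookup-tip : lookup ((A Vec.++ B) Vec.++ Vec.[ c ]) (encode tip) ≡ c
    lookup-tip = Vec.lookup-++ʳ (A Vec.++ B) Vec.[ c ] zero

  data Over (e : Fin n) : Elt n m → Set where
    base : Over e (base e)
    copy : ∀ j → Over e (copy e j)

  data NonBase : Elt n m → Set where
    copy : ∀ e j → NonBase (copy e j)
    tip  : NonBase tip

  lookup-embed-nonbase : ∀ S {z} → NonBase z → lookup (embed m S) (encode z) ≡ false
  lookup-embed-nonbase S (copy e j) = trans (lookup-copy S _ false e j) (Vec.lookup-replicate (combine e j) false)
  lookup-embed-nonbase S tip        = lookup-tip S (Vec.replicate _ false) false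

  lookup-qSet : ∀ S {e z} → Over e z → lookup (qSet m S) (encode z) ≡ lookup S e
  lookup-qSet S {e} base     = lookup-base S _ true e
  lookup-qSet S {e} (copy j) = begin
    lookup (qSet m S) (encode (copy e j))              ≡⟨ lookup-copy S _ true e j ⟩
    lookup (Vec.concat rows) (combine e j)             ≡⟨ Vec.lookup-concat rows e j ⟩
    lookup (lookup rows e) j                           ≡⟨ cong (λ v → lookup v j) (Vec.lookup-map e (Vec.replicate m) S) ⟩
    lookup (Vec.replicate m (lookup S e)) j            ≡⟨ Vec.lookup-replicate j (lookup S e) ⟩
    lookup S e                                         ∎
    where
    open ≡-Reasoning
    rows = Vec.map (Vec.replicate m) S

  ∈-bases⁺ : ∀ {e} {xs : List (Elt n m)} → base e ∈ xs → e ∈ bases xs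
  ∈-bases⁺ (here refl)                     = here refl
  ∈-bases⁺ {xs = base _ ∷ _}   (there z∈) = there (∈-bases⁺ z∈)
  ∈-bases⁺ {xs = copy _ _ ∷ _} (there z∈) = ∈-bases⁺ z∈
  ∈-bases⁺ {xs = tip ∷ _}      (there z∈) = ∈-bases⁺ z∈

  ∈-bases⁻ : ∀ {e} (xs : List (Elt n m)) → e ∈ bases xs → base e ∈ xs
  ∈-bases⁻ (base _ ∷ xs)   (here refl) = here refl
  ∈-bases⁻ (base _ ∷ xs)   (there e∈)  = there (∈-bases⁻ xs e∈)
  ∈-bases⁻ (copy _ _ ∷ xs) e∈          = there (∈-bases⁻ xs e∈)
  ∈-bases⁻ (tip ∷ xs)      e∈          = there (∈-bases⁻ xs e∈)

  ∈-support⁺ : ∀ {e z} {xs : List (Elt n m)} → Over e z → z ∈ xs → e ∈ support xs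
  ∈-support⁺ base     (here refl) = here refl
  ∈-support⁺ (copy j) (here refl) = here refl
  ∈-support⁺ {xs = base _ ∷ _}   o (there z∈) = there (∈-support⁺ o z∈)
  ∈-support⁺ {xs = copy _ _ ∷ _} o (there z∈) = there (∈-support⁺ o z∈)
  ∈-support⁺ {xs = tip ∷ _}      o (there z∈) = ∈-support⁺ o z∈

  ∈-support⁻ : ∀ {e} (xs : List (Elt n m)) → e ∈ support xs → ∃ λ z → Over e z × z ∈ xs
  ∈-support⁻ (base _ ∷ xs)   (here refl) = _ , base , here refl
  ∈-support⁻ (copy _ j ∷ xs) (here refl) = _ , copy j , here refl
  ∈-support⁻ (base _ ∷ xs)   (there e∈)  = let (z , o , z∈) = ∈-support⁻ xs e∈ in z , o , there z∈
  ∈-support⁻ (copy _ _ ∷ xs) (there e∈)  = let (z , o , z∈) = ∈-support⁻ xs e∈ in z , o , there z∈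
  ∈-support⁻ (tip ∷ xs)      e∈          = let (z , o , z∈) = ∈-support⁻ xs e∈ in z , o , there z∈

  ∈-nonbase⁺ : ∀ {z} {xs : List (Elt n m)} → NonBase z → z ∈ xs → z ∈ nonbase xs
  ∈-nonbase⁺ (copy _ _) (here refl) = here refl
  ∈-nonbase⁺ tip        (here refl) = here refl
  ∈-nonbase⁺ {xs = base _ ∷ _}   b (there z∈) = ∈-nonbase⁺ b z∈
  ∈-nonbase⁺ {xs = copy _ _ ∷ _} b (there z∈) = there (∈-nonbase⁺ b z∈)
  ∈-nonbase⁺ {xs = tip ∷ _}      b (there z∈) = there (∈-nonbase⁺ b z∈)

  ∈-nonbase⁻ : ∀ {z} (xs : List (Elt n m)) → z ∈ nonbase xs → NonBase z × z ∈ xs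
  ∈-nonbase⁻ (copy e j ∷ xs) (here refl) = copy e j , here refl
  ∈-nonbase⁻ (tip ∷ xs)      (here refl) = tip , here refl
  ∈-nonbase⁻ (base _ ∷ xs)   z∈          = let (b , z∈xs) = ∈-nonbase⁻ xs z∈ in b , there z∈xs
  ∈-nonbase⁻ (copy _ _ ∷ xs) (there z∈)  = let (b , z∈xs) = ∈-nonbase⁻ xs z∈ in b , there z∈xs
  ∈-nonbase⁻ (tip ∷ xs)      (there z∈)  = let (b , z∈xs) = ∈-nonbase⁻ xs z∈ in b , there z∈xs

  nonbase-unique : ∀ {xs : List (Elt n m)} → Unique xs → Unique (nonbase xs)
  nonbase-unique [] = []
  nonbase-unique {base _ ∷ xs}   (_ ∷ xs!)  = nonbase-unique xs!
  nonbase-unique {copy _ _ ∷ xs} (x∉ ∷ xs!) =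
    All.tabulate (λ y∈ → All.lookup x∉ (proj₂ (∈-nonbase⁻ xs y∈))) ∷ nonbase-unique xs!
  nonbase-unique {tip ∷ xs}      (x∉ ∷ xs!) =
    All.tabulate (λ y∈ → All.lookup x∉ (proj₂ (∈-nonbase⁻ xs y∈))) ∷ nonbase-unique xs!

  length-bases+nonbase : ∀ (xs : List (Elt n m)) → length (bases xs) + length (nonbase xs) ≡ length xs
  length-bases+nonbase []              = refl
  length-bases+nonbase (base _ ∷ xs)   = cong suc (length-bases+nonbase xs)
  length-bases+nonbase (copy _ _ ∷ xs) = trans (+-suc _ _) (cong suc (length-bases+nonbase xs))
  length-bases+nonbase (tip ∷ xs)      = trans (+-suc _ _) (cong suc (length-bases+nonbase xs))

  length-support : ∀ (xs : List (Elt n m)) → length (support xs) ≤ length xs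
  length-support []              = z≤n
  length-support (base _ ∷ xs)   = s≤s (length-support xs)
  length-support (copy _ _ ∷ xs) = s≤s (length-support xs)
  length-support (tip ∷ xs)      = m≤n⇒m≤1+n (length-support xs)

  act : (Fin n → Fin n) → Elt n m → Elt n m
  act f (base e)   = base (f e)
  act f (copy e j) = copy (f e) j
  act f tip        = tip

  act-injective : ∀ {f} → (∀ {i j} → f i ≡ f j → i ≡ j) → ∀ {x y} → act f x ≡ act f y → x ≡ y
  act-injective {f} inj {x} {y} eq = go x y eq
    where
    base-injective : ∀ {i j} → base {n} {m} i ≡ base j → i ≡ j
    base-injective refl = refl
    copy-injective : ∀ {i j k l} → copy {n} {m} i k ≡ copy j l → i ≡ j × k ≡ l
    copy-injective refl = refl , refl
    go : ∀ x y → act f x ≡ act f y → x ≡ y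
    go (base _)   (base _)   eq = cong base (inj (base-injective eq))
    go (copy _ _) (copy _ _) eq = let (p , q) = copy-injective eq in cong₂ copy (inj p) q
    go tip        tip        _  = refl

  bases-act : ∀ f xs → bases (map (act f) xs) ≡ map f (bases xs)
  bases-act f []              = refl
  bases-act f (base e ∷ xs)   = cong (f e ∷_) (bases-act f xs)
  bases-act f (copy _ _ ∷ xs) = bases-act f xs
  bases-act f (tip ∷ xs)      = bases-act f xs

  support-act : ∀ f xs → support (map (act f) xs) ≡ map f (support xs)
  support-act f []              = refl
  support-act f (base e ∷ xs)   = cong (f e ∷_) (support-act f xs)
  support-act f (copy e _ ∷ xs) = cong (f e ∷_) (support-act f xs)
  support-act f (tip ∷ xs)      = support-act f xs

  length-nonbase-act : ∀ f xs → length (nonbase (map (act f) xs)) ≡ length (nonbase xs)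
  length-nonbase-act f []              = refl
  length-nonbase-act f (base _ ∷ xs)   = length-nonbase-act f xs
  length-nonbase-act f (copy _ _ ∷ xs) = cong suc (length-nonbase-act f xs)
  length-nonbase-act f (tip ∷ xs)      = cong suc (length-nonbase-act f xs)

  coneRank-act : ∀ ρ f xs → coneRank ρ (map (act f) xs) ≡ coneRank (ρ ∘ map f) xs
  coneRank-act ρ f xs = cong₂ (λ a b → a ⊓ suc b)
    (cong₂ _+_ (cong ρ (bases-act f xs)) (length-nonbase-act f xs)) (cong ρ (support-act f xs))

  lift : (Fin n → Fin n) → Fin (coneSize n m) → Fin (coneSize n m)
  lift f = encode ∘ act f ∘ decode

  lift-injective : ∀ {f} → (∀ {i j} → f i ≡ f j → i ≡ j) → ∀ {x y} → lift f x ≡ lift f y → x ≡ y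
  lift-injective inj eq = decode-injective (act-injective inj
    (trans (sym (decode-encode _)) (trans (cong decode eq) (decode-encode _))))

  decode-lift : ∀ f xs → map decode (map (lift f) xs) ≡ map (act f) (map decode xs)
  decode-lift f xs = trans (sym (List.map-∘ xs)) (trans
    (List.map-cong (λ x → decode-encode (act f (decode x))) xs) (List.map-∘ xs))

  -- Covers the three ground sets of the theorem at once; constant blocks make them invariant under
  -- every lifted relabelling.
  uniform : Bool → Bool → Bool → Subset (coneSize n m)
  uniform a b c = (Vec.replicate n a Vec.++ Vec.replicate (n * m) b) Vec.++ Vec.[ c ]

  lift-uniform : ∀ a b c f {x} → x ∈ˢ uniform a b c → lift f x ∈ˢ uniform a b c
  lift-uniform a b c f {x} x∈ = Vec.lookup⇒[]= (lift f x) (uniform a b c) (trans (invariant (decode x))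
    (trans (cong (lookup (uniform a b c)) (encode-decode x)) (Vec.[]=⇒lookup x∈)))
    where
    A = Vec.replicate n a
    B = Vec.replicate (n * m) b
    invariant : ∀ z → lookup (uniform a b c) (encode (act f z)) ≡ lookup (uniform a b c) (encode z)
    invariant (base e) = trans (trans (lookup-base A B c (f e)) (Vec.lookup-replicate (f e) a))
      (sym (trans (lookup-base A B c e) (Vec.lookup-replicate e a)))
    invariant (copy e j) = trans (trans (lookup-copy A B c (f e) j) (Vec.lookup-replicate (combine (f e) j) b))
      (sym (trans (lookup-copy A B c e j) (Vec.lookup-replicate (combine e j) b)))
    invariant tip = refl

-- The rank formula for the free cone

module _ {n m : ℕ} {M : Matroid n} {Q : Matroid (coneSize n m)} (cone : IsFreeCone m M Q) where

  open IsFreeCone cone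

  module _ (ys : List (Fin (coneSize n m))) where

    private
      zs : List (Elt n m)
      zs = map decode ys

      Y : Subset (coneSize n m)
      Y = fromList ys

      decoded : ∀ (P : Fin (coneSize n m) → Set) → (∀ z → z ∈ zs → P (encode z)) → ∀ {x} → x ∈ˢ Y → P x
      decoded P h {x} x∈ = subst P (encode-decode {n} {m} x) (h (decode x) (∈-map⁺ decode (∈-fromList⁻ ys x∈)))

      encoded : ∀ {z} → z ∈ zs → encode z ∈ˢ Y
      encoded z∈ with ∈-map⁻ decode z∈
      ... | x , x∈ , refl = subst (_∈ˢ Y) (sym (encode-decode {n} {m} x)) (∈-fromList⁺ x∈)

    -- A cyclic flat of `M` keeps its rank in the cone, so one that is optimal for `bases zs` gives
    -- the bound, at the cost of its leftovers and all nonbase elements.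
    rank≤low : rk Q ys ≤ low (rk M) zs
    rank≤low with cyclicFlat-cover M (fromList (bases zs))
    ... | Z , cs , cf , cover , le = begin
      rk Q ys                                  ≤⟨ r-cover Q (embed m Z) ds (decoded _ covered) ⟩
      r Q (embed m Z) + length ds              ≡⟨ cong₂ _+_ (rankZ Z cf) (trans (List.length-++ (map (encode ∘ base) cs))
                                                    (cong₂ _+_ (List.length-map (encode ∘ base) cs) (List.length-map encode (nonbase zs)))) ⟩
      r M Z + (length cs + length (nonbase zs)) ≡⟨ +-assoc (r M Z) _ _ ⟨
      r M Z + length cs + length (nonbase zs)  ≤⟨ +-monoˡ-≤ _ le ⟩
      low (rk M) zs                            ∎
      where
      open ≤-Reasoning
      ds = map (encode ∘ base) cs ++ map encode (nonbase zs)
      nb : ∀ {z} → NonBase z → z ∈ zs → encode z ∈ˢ embed m Z ⊎ encode z ∈ ds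
      nb b z∈ = inj₂ (∈-++⁺ʳ (map (encode ∘ base) cs) (∈-map⁺ encode (∈-nonbase⁺ b z∈)))
      covered : ∀ z → z ∈ zs → encode z ∈ˢ embed m Z ⊎ encode z ∈ ds
      covered (base e) z∈ = [ (λ e∈Z → inj₁ (Vec.lookup⇒[]= _ (embed m Z)
                                 (trans (lookup-base Z _ false e) (Vec.[]=⇒lookup e∈Z))))
                            , (λ e∈cs → inj₂ (∈-++⁺ˡ (∈-map⁺ (encode ∘ base) e∈cs))) ]′
                            (cover (∈-fromList⁺ (∈-bases⁺ z∈)))
      covered (copy e j) = nb (copy e j)
      covered tip        = nb tip

    rank≤high : rk Q ys ≤ high (rk M) zs
    rank≤high with closure M (fromList (support zs))
    ... | F , ⊆F , flat , r≤ , _ with nonempty? F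
    ...   | yes ne = begin
      rk Q ys             ≤⟨ R2 Q _ _ (decoded _ inside) ⟩
      r Q (qSet m F)      ≡⟨ rankQ F flat ne ⟩
      r M F + 1           ≡⟨ +-comm (r M F) 1 ⟩
      suc (r M F)         ≤⟨ s≤s r≤ ⟩
      high (rk M) zs      ∎
      where
      open ≤-Reasoning
      over : ∀ {e z} → Over e z → z ∈ zs → encode z ∈ˢ qSet m F
      over o z∈ = Vec.lookup⇒[]= _ (qSet m F) (trans (lookup-qSet F o)
        (Vec.[]=⇒lookup (⊆F (∈-fromList⁺ (∈-support⁺ o z∈)))))
      inside : ∀ z → z ∈ zs → encode z ∈ˢ qSet m F
      inside (base e)   = over base
      inside (copy e j) = over (copy j)
      inside tip _      = Vec.lookup⇒[]= _ (qSet m F) (lookup-tip F _ true)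
    -- `rankQ` speaks of nonempty flats only. Here the support is empty, so at most the tip is
    -- present, and a single element has rank at most 1.
    ...   | no ¬ne = ≤-trans (R2 Q _ _ (decoded _ onlyTip))
                       (≤-trans (R1 Q ⁅ encode {n} {m} tip ⁆) (≤-trans (≤-reflexive (∣⁅x⁆∣≡1 (encode {n} {m} tip))) (s≤s z≤n)))
      where
      onlyTip : ∀ z → z ∈ zs → encode z ∈ˢ ⁅ encode {n} {m} tip ⁆
      onlyTip (base e)   z∈ = contradiction (e , ⊆F (∈-fromList⁺ (∈-support⁺ base z∈))) ¬ne
      onlyTip (copy e j) z∈ = contradiction (e , ⊆F (∈-fromList⁺ (∈-support⁺ (copy j) z∈))) ¬ne
      onlyTip tip        _  = x∈⁅x⁆ _

    -- The two kinds of cyclic flats of the cone yield the two terms of the minimum. Repetitions in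
    -- `ys` would inflate the length of `nonbase zs` without raising the rank, hence `Unique`.
    coneRank≤rank : Unique ys → coneRank (rk M) zs ≤ rk Q ys
    coneRank≤rank ys! with cyclicFlat-cover Q Y
    ... | Z , cs , cf , cover , le = [ caseE , caseQ ]′ (Equivalence.to (cyclicFlats Z) cf)
      where
      open ≤-Reasoning
      ws : List (Elt n m)
      ws = map decode cs
      covered : ∀ {z} → z ∈ zs → encode z ∈ˢ Z ⊎ z ∈ ws
      covered {z} z∈ = [ inj₁ , (λ x∈ → inj₂ (subst (_∈ ws) (decode-encode z) (∈-map⁺ decode x∈))) ]′
                         (cover (encoded z∈))
      caseE : (Σ (Subset n) λ Z′ → IsCyclicFlat M Z′ × Z ≡ embed m Z′) → coneRank (rk M) zs ≤ rk Q ys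
      caseE (Z′ , cf′ , refl) = begin
        coneRank (rk M) zs                                       ≤⟨ m⊓n≤m (low (rk M) zs) (high (rk M) zs) ⟩
        rk M (bases zs) + length (nonbase zs)                    ≤⟨ +-mono-≤
            (r-cover M Z′ (bases ws) (λ e∈ → basesCovered (∈-bases⁻ zs (∈-fromList⁻ (bases zs) e∈))))
            (unique⇒length≤ (nonbase-unique (Unique.map⁺ decode-injective ys!)) nonbaseCovered) ⟩
        r M Z′ + length (bases ws) + length (nonbase ws)         ≡⟨ +-assoc (r M Z′) _ _ ⟩
        r M Z′ + (length (bases ws) + length (nonbase ws))       ≡⟨ cong₂ _+_ (sym (rankZ Z′ cf′))
            (trans (length-bases+nonbase ws) (List.length-map (decode {n} {m}) cs)) ⟩
        r Q Z + length cs                                        ≤⟨ le ⟩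
        rk Q ys                                                  ∎
        where
        basesCovered : ∀ {e} → base e ∈ zs → e ∈ˢ Z′ ⊎ e ∈ bases ws
        basesCovered {e} z∈ = [ (λ x∈ → inj₁ (Vec.lookup⇒[]= e Z′
                                   (trans (sym (lookup-base Z′ _ false e)) (Vec.[]=⇒lookup x∈))))
                              , inj₂ ∘ ∈-bases⁺ ]′ (covered z∈)
        -- An embedded flat contains no nonbase element, so all of these are among the leftovers.
        nonbaseCovered : nonbase zs ⊆ nonbase ws
        nonbaseCovered z∈ with ∈-nonbase⁻ zs z∈
        ... | b , z∈zs = [ (λ x∈ → contradiction (trans (sym (Vec.[]=⇒lookup x∈)) (lookup-embed-nonbase Z′ b)) λ ())
                         , ∈-nonbase⁺ b ]′ (covered z∈zs)
      caseQ : (Σ (Subset n) λ F → IsFlat M F × Nonempty F × Z ≡ qSet m F) → coneRank (rk M) zs ≤ rk Q ys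
      caseQ (F , flat , ne , refl) = begin
        coneRank (rk M) zs                ≤⟨ m⊓n≤n (low (rk M) zs) (high (rk M) zs) ⟩
        suc (rk M (support zs))           ≤⟨ s≤s (r-cover M F (support ws) (λ e∈ →
                                               supportCovered (∈-support⁻ zs (∈-fromList⁻ (support zs) e∈)))) ⟩
        suc (r M F) + length (support ws) ≤⟨ +-mono-≤ (≤-reflexive (trans (+-comm 1 (r M F)) (sym (rankQ F flat ne))))
                                               (≤-trans (length-support ws) (≤-reflexive (List.length-map (decode {n} {m}) cs))) ⟩
        r Q Z + length cs                 ≤⟨ le ⟩
        rk Q ys                           ∎
        where
        supportCovered : ∀ {e} → (∃ λ z → Over e z × z ∈ zs) → e ∈ˢ F ⊎ e ∈ support ws
        supportCovered {e} (z , o , z∈) = [ (λ x∈ → inj₁ (Vec.lookup⇒[]= e F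
                                               (trans (sym (lookup-qSet F o)) (Vec.[]=⇒lookup x∈))))
                                          , inj₂ ∘ ∈-support⁺ o ]′ (covered z∈)

    rank≡coneRank : Unique ys → rk Q ys ≡ coneRank (rk M) zs
    rank≡coneRank ys! = ≤-antisym (⊓-glb rank≤low rank≤high) (coneRank≤rank ys!)

-- Averaging the cone's rank sequences over relabellings

scan-map : ∀ {A B : Set} (f : List B → ℕ) (g : A → B) acc xs →
           scan f (map g acc) (map g xs) ≡ scan (f ∘ map g) acc xs
scan-map f g acc []       = refl
scan-map f g acc (x ∷ xs) rewrite sym (List.map-++ g acc (x ∷ [])) =
  cong (f (map g (acc ∷ʳ x)) ∷_) (scan-map f g (acc ∷ʳ x) xs)

module _ {n m : ℕ} {M : Matroid n} {Q : Matroid (coneSize n m)} (cone : IsFreeCone m M Q) where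

  scan-rank≡coneRank : ∀ {ys} → Unique ys → scan (rk Q) [] ys ≡ scan (coneRank (rk M)) [] (map decode ys)
  scan-rank≡coneRank {ys} ys! = trans
    (scan-cong [] ys λ p q eq → rank≡coneRank cone p (subst Unique (take-length-++ p q)
       (Unique.take⁺ (length p) (subst Unique eq ys!))))
    (sym (scan-map (coneRank (rk M)) decode [] ys))

  -- Relabelling a cone arrangement amounts to relabelling the rank function of `M` while the
  -- arrangement stays put.
  rankSeq-lift : ∀ {f} → (∀ {i j} → f i ≡ f j → i ≡ j) → ∀ {ys} → Unique ys →
    rankSeq (r Q) (map (lift {n} {m} f) ys) ≡ differences 0 (scan (coneRank (rk M ∘ map f)) [] (map decode ys))
  rankSeq-lift {f} inj {ys} ys! = begin
    rankSeq (r Q) (map (lift {n} {m} f) ys)                     ≡⟨ rankSeqFrom≡differences Q [] _ ⟩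
    differences (rk Q []) (scan (rk Q) [] (map (lift f) ys))    ≡⟨ cong₂ differences (r⊥≡0 Q)
      (trans (scan-rank≡coneRank (Unique.map⁺ (lift-injective inj) ys!))
        (trans (cong (scan (coneRank (rk M)) []) (decode-lift f ys))
          (trans (scan-map (coneRank (rk M)) (act f) [] (map decode ys))
                 (scan-cong [] (map decode ys) λ p _ _ → coneRank-act (rk M) f p)))) ⟩
    differences 0 (scan (coneRank (rk M ∘ map f)) [] (map decode ys)) ∎
    where open ≡-Reasoning

module _ {n m : ℕ} {M N : Matroid n} (G≡ : ∀ s → G M s ≡ G N s)
         {QM QN : Matroid (coneSize n m)} (coneM : IsFreeCone m M QM) (coneN : IsFreeCone m N QN) where

  GRestr-uniform : ∀ a b c s → GRestr QM (uniform {n} {m} a b c) s ≡ GRestr QN (uniform {n} {m} a b c) s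
  GRestr-uniform a b c s = *-cancelˡ-≡ _ _ (length P) (begin
    length P * GRestr QM X s  ≡⟨ average coneM ⟩
    ∑ (arrangements X) (λ σ → ∑ P (λ τ → h (scan (coneRank (ranks M τ)) [] (map decode σ))))
      ≡⟨ ∑-cong (arrangements X) (λ {σ} _ → ∑-coneRank h M N G≡ (map decode σ)) ⟩
    ∑ (arrangements X) (λ σ → ∑ P (λ τ → h (scan (coneRank (ranks N τ)) [] (map decode σ))))
      ≡⟨ average coneN ⟨
    length P * GRestr QN X s  ∎)
    where
    open ≡-Reasoning
    P = permutations n
    X = uniform {n} {m} a b c
    instance
      P-nonZero : NonZero (length P)
      P-nonZero = >-nonZero (∈-length (allFin∈permutations n))
    h : List ℕ → ℕ
    h l = 𝟙 (differences 0 l ≟ᴸ s)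
    average : ∀ {L Q} → IsFreeCone m L Q → length P * GRestr Q X s
      ≡ ∑ (arrangements X) (λ σ → ∑ P (λ τ → h (scan (coneRank (ranks L τ)) [] (map decode σ))))
    average {L} {Q} cone = begin
      length P * GRestr Q X s             ≡⟨ cong (length P *_) (GRestr-∑ Q X s) ⟩
      length P * ∑ (arrangements X) ind   ≡⟨ ∑-const (∑ (arrangements X) ind) P ⟨
      ∑ P (λ _ → ∑ (arrangements X) ind)  ≡⟨ ∑-cong P (λ {τ} τ∈ → ∑-map-arrangements X (lift {n} {m} (apply τ))
        (lift-injective (apply-injective τ∈)) (lift-uniform a b c (apply τ)) ind) ⟨
      ∑ P (λ τ → ∑ (arrangements X) (λ σ → ind (map (lift {n} {m} (apply τ)) σ)))
        ≡⟨ ∑-cong P (λ {τ} τ∈ → ∑-cong (arrangements X) (λ {σ} σ∈ → cong (λ l → 𝟙 (l ≟ᴸ s))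
             (rankSeq-lift cone (apply-injective τ∈) (proj₁ (proj₂ (∈-arrangements⁻ {X = X} σ∈)))))) ⟩
      ∑ P (λ τ → ∑ (arrangements X) (λ σ → h (scan (coneRank (ranks L τ)) [] (map decode σ))))
        -- With `σ` outermost, the inner sum has the fixed cone arrangement that `∑-coneRank`
        -- requires.
        ≡⟨ ∑-swap _ P (arrangements X) ⟩
      ∑ (arrangements X) (λ σ → ∑ P (λ τ → h (scan (coneRank (ranks L τ)) [] (map decode σ)))) ∎
      where
      ind : List (Fin (coneSize n m)) → ℕ
      ind σ = 𝟙 (rankSeq (r Q) σ ≟ᴸ s)

-- The rank sequence of `allFin n₁` occurs for `M`, hence for `N`, and its length is the size of
-- either ground set.
G-determines-size : ∀ {n₁ n₂} (M : Matroid n₁) (N : Matroid n₂) → (∀ s → G M s ≡ G N s) → n₁ ≡ n₂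
G-determines-size {n₁} {n₂} M N G≡ = size (∈-map⁻ (rankSeq (r N)) s∈)
  where
  open ≡-Reasoning
  s = rankSeq (r M) (allFin n₁)
  count-G : ∀ {n} (L : Matroid n) → G L s ≡ count _≟ᴸ_ s (map (rankSeq (r L)) (permutations n))
  count-G {n} L = trans (GRestr-∑ L ⊤ s) (sym (∑-map _ (rankSeq (r L)) (permutations n)))
  s∈ : s ∈ map (rankSeq (r N)) (permutations n₂)
  s∈ = count>0⇒∈ _≟ᴸ_ s _ (subst (0 <_) (trans (sym (count-G M)) (trans (G≡ s) (count-G N)))
         (∈⇒count>0 _≟ᴸ_ (∈-map⁺ (rankSeq (r M)) (allFin∈permutations n₁))))
  size : (∃ λ π → π ∈ permutations n₂ × s ≡ rankSeq (r N) π) → n₁ ≡ n₂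
  size (π , π∈ , eq) = begin
    n₁                            ≡⟨ List.length-tabulate {n = n₁} id ⟨
    length (allFin n₁)            ≡⟨ length-rankSeqFrom M ⊥ (allFin n₁) ⟨
    length s                      ≡⟨ cong length eq ⟩
    length (rankSeq (r N) π)      ≡⟨ length-rankSeqFrom N ⊥ π ⟩
    length π                      ≡⟨ proj₂ (∈-permutations⁻ π∈) ⟩
    n₂                            ∎

theorem4p3 : (m : ℕ) → 1 ≤ m →
    ∀ {n₁ n₂} (M : Matroid n₁) (N : Matroid n₂) →
    Loopless M → Loopless N →
    (∀ s → G M s ≡ G N s) →
    (QM : Matroid (coneSize n₁ m)) (QN : Matroid (coneSize n₂ m)) →
    IsFreeCone m M QM → IsFreeCone m N QN →
    (∀ s → GRestr QM (withoutTip n₁ m) s ≡ GRestr QN (withoutTip n₂ m) s)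
    × (∀ s → GRestr QM (withoutE n₁ m) s ≡ GRestr QN (withoutE n₂ m) s)
    × (∀ s → GRestr QM (withoutEa n₁ m) s ≡ GRestr QN (withoutEa n₂ m) s)
theorem4p3 m _ M N _ _ G≡ QM QN coneM coneN with refl ← G-determines-size M N G≡ =
    -- `⊤` and `⊥` unfold to constant vectors, so the subsets in the statement are instances of
    -- `uniform` by computation.
    GRestr-uniform G≡ coneM coneN true true false
  , GRestr-uniform G≡ coneM coneN false true true
  , GRestr-uniform G≡ coneM coneN false true false
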